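{- Let $n\geq3$ and $k\geq3$, and let $\lambda(N,k)$ denote the maximum period of a $k$-ary orientable sequence of order $N$. Then, with $s_k(n-1)$ as defined in the context, \[ \frac{k\,s_k(n-1)}{\lambda(n+1,k)}\rightarrow 1 \text{ as } n\rightarrow\infty\ (k\text{ fixed}),\qquad \frac{k\,s_k(n-1)}{\lambda(n+1,k)}\rightarrow 1 \text{ as } k\rightarrow\infty\ (n\text{ fixed}). \]
   Context: A $k$-ary sequence is a periodic sequence $S=(s_i)$ with entries in $\mathbb{Z}_k$; its period is the least positive $p$ with $s_{i+p}=s_i$ for all $i$. Write $\mathbf{s}_N(i)=(s_i,\dots,s_{i+N-1})$. $S$ is an $N$-window sequence if $\mathbf{s}_N(i)=\mathbf{s}_N(j)$ implies $i\equiv j\pmod p$. An orientable sequence of order $N$ is a $k$-ary $N$-window sequence with $\mathbf{s}_N(i)\neq\mathbf{s}_N(j)^R$ for all $i,j$, where $\mathbf{u}^R$ is the reverse of $\mathbf{u}$. Let $\delta=1$ if $k$ is odd and $\delta=2$ if $k$ is even, and write $n=2^tm$ with $m$ odd. Define $s_k(n-1)=\frac{k^n-\delta(n(k^{(n-1)/2}-1)+1)}{2}$ if $n$ is odd, and $s_k(n-1)=\frac{k^n - \frac{nk^{(n-2)/2}}{2}(\delta^2+k) +n\delta k^{(m-1)/2} - m\delta(k^{(m-1)/2}-1)-\delta}{2}$ if $n$ is even. -}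

module Defs where

open import Data.Nat as ℕ using (ℕ; zero; suc; _≤_; _<_; _∸_; NonZero)
open import Data.Nat.Properties using (_≟_; m*n≢0)
open import Data.Fin using (Fin)
open import Data.Integer as ℤ using (ℤ; +_)
open import Data.Rational as ℚ using (ℚ)
open import Data.Product using (Σ; _×_)
open import Data.Sum using (_⊎_)
open import Relation.Nullary using (¬_; yes; no)
open import Relation.Binary.PropositionalEquality using (_≡_)

IsPeriodOf : {k : ℕ} → (ℕ → Fin k) → ℕ → Set
IsPeriodOf s p = ∀ i → s (i ℕ.+ p) ≡ s i

HasPeriod : {k : ℕ} → (ℕ → Fin k) → ℕ → Set
HasPeriod s p = (0 < p) × IsPeriodOf s p × (∀ q → 0 < q → q < p → ¬ IsPeriodOf s q)

SameWindow : {k : ℕ} → (ℕ → Fin k) → ℕ → ℕ → ℕ → Set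
SameWindow s N i j = ∀ r → r < N → s (i ℕ.+ r) ≡ s (j ℕ.+ r)

ReverseWindow : {k : ℕ} → (ℕ → Fin k) → ℕ → ℕ → ℕ → Set
ReverseWindow s N i j = ∀ r → r < N → s (i ℕ.+ r) ≡ s (j ℕ.+ (N ∸ 1 ∸ r))

CongMod : ℕ → ℕ → ℕ → Set
CongMod i j p = Σ ℕ λ q → (i ℕ.+ q ℕ.* p ≡ j) ⊎ (j ℕ.+ q ℕ.* p ≡ i)

IsWindowSeq : {k : ℕ} → (ℕ → Fin k) → ℕ → ℕ → Set
IsWindowSeq s p N = HasPeriod s p ×
  (∀ i j → SameWindow s N i j → CongMod i j p)

IsOrientable : {k : ℕ} → (ℕ → Fin k) → ℕ → ℕ → Set
IsOrientable s p N = IsWindowSeq s p N × (∀ i j → ¬ ReverseWindow s N i j)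

IsMaxOrientablePeriod : ℕ → ℕ → ℕ → Set
IsMaxOrientablePeriod N k L =
  Σ (ℕ → Fin k) (λ s → IsOrientable s L N) ×
  (∀ (s : ℕ → Fin k) p → IsOrientable s p N → p ≤ L)

-- odd part m of n = 2^t m (fuel-based recursion; fuel n suffices; oddPart 0 = 0)
oddPartAux : ℕ → ℕ → ℕ
oddPartAux zero n = n
oddPartAux (suc f) zero = zero
oddPartAux (suc f) (suc n) with (suc n) ℕ.% 2 ≟ 0
... | yes _ = oddPartAux f ((suc n) ℕ./ 2)
... | no _ = suc n

oddPart : ℕ → ℕ
oddPart n = oddPartAux n n

δ : ℕ → ℕ
δ k with k ℕ.% 2 ≟ 0
... | yes _ = 2
... | no _ = 1

-- 2 · s_k(n-1) as an integer (the formula of the context, times 2)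
twiceSk : ℕ → ℕ → ℤ
twiceSk k n with n ℕ.% 2 ≟ 0
... | no _ = + (k ℕ.^ n) ℤ.- (+ δ k) ℤ.* ((+ n) ℤ.* (+ (k ℕ.^ ((n ∸ 1) ℕ./ 2)) ℤ.- + 1) ℤ.+ + 1)
... | yes _ = let m = oddPart n ; d = δ k ; km = k ℕ.^ ((m ∸ 1) ℕ./ 2) in
  + (k ℕ.^ n)
  ℤ.- (+ ((n ℕ./ 2) ℕ.* k ℕ.^ ((n ∸ 2) ℕ./ 2))) ℤ.* (+ (d ℕ.* d ℕ.+ k))
  ℤ.+ (+ (n ℕ.* d ℕ.* km))
  ℤ.- (+ (m ℕ.* d)) ℤ.* ((+ km) ℤ.- + 1)
  ℤ.- (+ d)

sk : ℕ → ℕ → ℚ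
sk k n = twiceSk k n ℚ./ 2

ratio : (k n L : ℕ) → .{{_ : NonZero L}} → ℚ
ratio k n L = ((+ k) ℤ.* twiceSk k n) ℚ./ (2 ℕ.* L)
  where instance _ = m*n≢0 2 L

{-# OPTIONS --safe #-}

-- A word of length n + 1 over Z_k is given by its first letter a and the word d of its n successive
-- differences; reversing it replaces d by star d, the reversed negated word.  Let C be the set of d
-- whose largest rotation exceeds the largest rotation of star d, where d is read as a number in
-- which the difference 1 is the largest digit and -1 the smallest.  C is closed under rotation and
-- disjoint from its image under star, so the words (a , d) with d in C form the edges of a balanced
-- subgraph of the de Bruijn graph on which every Euler tour is an orientable sequence.  Changing a
-- letter of d to 1 does not leave C, so following such changes every edge leads to the cycle on
-- which all differences are 1; hence the subgraph is connected and has an Euler tour.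
-- If neither d nor star d is in C then d is a concatenation of two words fixed by star, and there
-- are at most (n + 1) k^(⌊n/2⌋ + 1) of those.  Thus the maximal period L satisfies
-- k^(n+1) - k (n + 1) k^(⌊n/2⌋ + 1) ≤ 2 L ≤ k^(n+1), and 2 s_k(n-1) differs from k^n by at most
-- 11 n k^(⌊n/2⌋ + 1).

module Submission where

open import Algebra.Bundles using (Group)
import Algebra.Properties.Group as GroupProperties
open import Data.Fin as Fin using (Fin; toℕ; fromℕ<; splitAt; funToFin; finToFun; zero; suc)
open import Data.Fin.Properties
  using (toℕ-injective; toℕ-fromℕ<; toℕ<n; injective⇒≤; finToFun-funToFin; +↔⊎)
open import Data.Integer as ℤ using (ℤ; +_; +[1+_]; -[1+_])
import Data.Integer.Properties as ℤ
import Data.Integer.Tactic.RingSolver as ℤ-RingSolver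
open import Data.List using
  ( List; []; _∷_; _++_; _∷ʳ_; length; map; reverse; lookup; replicate; take; drop; applyUpTo; upTo
  ; concatMap; allFin; cartesianProduct; cartesianProductWith )
import Data.List.Membership.DecPropositional as DecMembership
open import Data.List.Membership.Propositional using (_∈_; _∉_; lose)
open import Data.List.Membership.Propositional.Properties
open import Data.List.Properties
open import Data.List.Relation.Binary.Permutation.Propositional using (_↭_; ↭⇒↭ₛ; ↭-sym)
open import Data.List.Relation.Binary.Permutation.Propositional.Properties using (∈-resp-↭; shifts)
import Data.List.Relation.Binary.Permutation.Setoid.Properties as ↭ₛ
open import Data.List.Relation.Binary.Pointwise as Pw using (Pointwise; []; _∷_)
open import Data.List.Relation.Unary.All as All using ([]; _∷_)
open import Data.List.Relation.Unary.AllPairs using ([]; _∷_)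
open import Data.List.Relation.Unary.Any using (index; here; there)
open import Data.List.Relation.Unary.Any.Properties using (lookup-index)
open import Data.List.Relation.Unary.Unique.Propositional using (Unique)
import Data.List.Relation.Unary.Unique.Propositional.Properties as Unique
open import Data.Nat as ℕ using
  ( ℕ; zero; suc; _+_; _*_; _∸_; _^_; _/_; _%_; _⊔_; _≤_; _<_; _<?_; z≤n; s≤s; s≤s⁻¹; ⌊_/2⌋; ⌈_/2⌉
  ; NonZero; >-nonZero⁻¹ )
open import Data.Nat.DivMod hiding (_/_; _%_)
open import Data.Nat.GeneralisedArithmetic using (iterate)
open import Data.Nat.Properties
open import Data.Nat.Tactic.RingSolver using (solve-∀)
open import Data.Product using (∃; ∃₂; _×_; _,_; proj₁; proj₂; uncurry)
open import Data.Product.Properties using () renaming (≡-dec to ×-≡-dec)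
open import Data.Rational as ℚ using (ℚ; mkℚ; 0ℚ; 1ℚ)
import Data.Rational.Properties as ℚ
open import Data.Rational.Unnormalised as ℚᵘ using (mkℚᵘ; 1ℚᵘ)
import Data.Rational.Unnormalised.Properties as ℚᵘ
open import Data.Sum using (_⊎_; inj₁; inj₂)
open import Function using (_∘_; id)
open import Function.Bundles using (Injection)
open import Function.Properties.Inverse using (↔⇒↣)
open import Relation.Binary using (tri<; tri≈; tri>)
open import Relation.Binary.PropositionalEquality
open import Relation.Nullary using (¬_; yes; no; contradiction; Dec)
open import Relation.Nullary.Decidable using (_×-dec_; map′)
open import Relation.Unary using (Decidable)

open import Defs

-- Iterates, lists without repetition, rotations of words and finite maxima

module _ {A : Set} where

  iterate-outer : ∀ (f : A → A) x m → iterate f x (suc m) ≡ f (iterate f x m)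
  iterate-outer f x zero    = refl
  iterate-outer f x (suc m) = iterate-outer f (f x) m

  iterate-+ : ∀ (f : A → A) x m n → iterate f x (m + n) ≡ iterate f (iterate f x m) n
  iterate-+ f x zero    n = refl
  iterate-+ f x (suc m) n = iterate-+ f (f x) m n

  iterate-closed : ∀ (P : A → Set) (f : A → A) → (∀ {x} → P x → P (f x)) →
                   ∀ {x} m → P x → P (iterate f x m)
  iterate-closed P f step zero    p = p
  iterate-closed P f step (suc m) p = iterate-closed P f step m (step p)

  iterate-invariant : ∀ {B : Set} (g : A → B) (f : A → A) → (∀ x → g (f x) ≡ g x) →
                      ∀ x m → g (iterate f x m) ≡ g x
  iterate-invariant g f inv x zero    = refl
  iterate-invariant g f inv x (suc m) = trans (iterate-invariant g f inv (f x) m) (inv x)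

module _ {A : Set} where

  lookup-injective : ∀ {xs : List A} → Unique xs → ∀ {i j} → lookup xs i ≡ lookup xs j → i ≡ j
  lookup-injective (x∉ ∷ u) {zero}  {zero}  eq = refl
  lookup-injective (x∉ ∷ u) {zero}  {suc j} eq = contradiction eq (All.lookup x∉ (∈-lookup j))
  lookup-injective (x∉ ∷ u) {suc i} {zero}  eq = contradiction (sym eq) (All.lookup x∉ (∈-lookup i))
  lookup-injective (x∉ ∷ u) {suc i} {suc j} eq = cong suc (lookup-injective u eq)

  unique-⊆⇒length≤ : ∀ {xs ys : List A} → Unique xs → (∀ {x} → x ∈ xs → x ∈ ys) →
                     length xs ≤ length ys
  unique-⊆⇒length≤ {xs} {ys} u sub = injective⇒≤ {f = f} f-injective
    where
    f : Fin (length xs) → Fin (length ys)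
    f i = index (sub (∈-lookup {xs = xs} i))
    f-injective : ∀ {i j} → f i ≡ f j → i ≡ j
    f-injective {i} {j} eq = lookup-injective u (trans (lookup-index (sub (∈-lookup i)))
      (trans (cong (lookup ys) eq) (sym (lookup-index (sub (∈-lookup j))))))

  ++-split : ∀ {a b c d : List A} → length a ≡ length c → a ++ b ≡ c ++ d → a ≡ c × b ≡ d
  ++-split {[]}    {b} {[]}    {d} l eq = refl , eq
  ++-split {x ∷ a} {b} {y ∷ c} {d} l eq with ++-split {a} {b} {c} {d} (suc-injective l) (∷-injectiveʳ eq)
  ... | a≡c , b≡d = cong₂ _∷_ (∷-injectiveˡ eq) a≡c , b≡d

  rot : List A → List A
  rot []      = []
  rot (x ∷ t) = t ∷ʳ x

  rotate : ℕ → List A → List A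
  rotate i d = iterate rot d i

  length-rot : ∀ d → length (rot d) ≡ length d
  length-rot []      = refl
  length-rot (x ∷ t) = trans (length-++ t) (+-comm (length t) 1)

  length-rotate : ∀ i d → length (rotate i d) ≡ length d
  length-rotate i d = iterate-invariant length rot length-rot d i

  rotate-++ : ∀ x y → rotate (length x) (x ++ y) ≡ y ++ x
  rotate-++ []      y = sym (++-identityʳ y)
  rotate-++ (c ∷ x) y = begin
    rotate (length x) ((x ++ y) ∷ʳ c)   ≡⟨ cong (rotate (length x)) (++-assoc x y _) ⟩
    rotate (length x) (x ++ (y ∷ʳ c))   ≡⟨ rotate-++ x (y ∷ʳ c) ⟩
    (y ∷ʳ c) ++ x                       ≡⟨ ++-assoc y _ x ⟩
    y ++ c ∷ x                          ∎
    where open ≡-Reasoning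

  -- Each step moves one letter of y to the end of x; i may exceed the length, in which case the
  -- exchange starts over.
  rotate-split : ∀ i d → ∃₂ λ x y → d ≡ x ++ y × rotate i d ≡ y ++ x
  rotate-split zero    d = [] , d , refl , sym (++-identityʳ d)
  rotate-split (suc i) d with rotate-split i d
  ... | x , c ∷ y , d≡ , r≡ = x ∷ʳ c , y , trans d≡ (sym (++-assoc x _ y)) ,
        trans (iterate-outer rot d i) (trans (cong rot r≡) (++-assoc y x _))
  ... | [] , [] , d≡ , r≡ = [] , [] , d≡ , trans (iterate-outer rot d i) (cong rot r≡)
  -- All letters have been moved, so the rotated word is d again and the next step starts with a
  -- one-letter prefix.
  ... | c ∷ x , [] , d≡ , r≡ = c ∷ [] , x , trans d≡ (++-identityʳ _) ,
        trans (iterate-outer rot d i) (cong rot r≡)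

  rotate-back : ∀ i d → ∃ λ j → rotate j (rotate i d) ≡ d
  rotate-back i d with rotate-split i d
  ... | x , y , refl , r≡ = length y , trans (cong (rotate (length y)) r≡) (rotate-++ y x)

  replicate-∷ʳ : ∀ n (x : A) → replicate n x ∷ʳ x ≡ replicate (suc n) x
  replicate-∷ʳ zero    x = refl
  replicate-∷ʳ (suc n) x = cong (x ∷_) (replicate-∷ʳ n x)

  rotate-replicate : ∀ i n (x : A) → rotate i (replicate n x) ≡ replicate n x
  rotate-replicate zero    n       x = refl
  rotate-replicate (suc i) zero    x = rotate-replicate i zero x
  rotate-replicate (suc i) (suc n) x =
    trans (cong (rotate i) (replicate-∷ʳ n x)) (rotate-replicate i (suc n) x)

maxUpTo : (ℕ → ℕ) → ℕ → ℕ
maxUpTo f zero    = f 0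
maxUpTo f (suc n) = maxUpTo f n ⊔ f (suc n)

≤maxUpTo : ∀ f n {i} → i ≤ n → f i ≤ maxUpTo f n
≤maxUpTo f zero    z≤n = ≤-refl
≤maxUpTo f (suc n) i≤ with m≤n⇒m<n∨m≡n i≤
... | inj₁ (s≤s i≤n) = ≤-trans (≤maxUpTo f n i≤n) (m≤m⊔n _ _)
... | inj₂ refl      = m≤n⊔m _ _

maxUpTo-attained : ∀ f n → ∃ λ i → maxUpTo f n ≡ f i
maxUpTo-attained f zero    = 0 , refl
maxUpTo-attained f (suc n) with ⊔-sel (maxUpTo f n) (f (suc n)) | maxUpTo-attained f n
... | inj₁ eq | i , eq′ = i , trans eq eq′
... | inj₂ eq | _       = suc n , eq

-- The group Z_k and the star operation on words of differences

module Cyclic (k′ : ℕ) where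

  k : ℕ
  k = suc k′

  infixl 6 _⊕_ _⊖_

  abstract

    res : ℕ → Fin k
    res m = m mod k

    toℕ-res : ∀ m → toℕ (res m) ≡ m % k
    toℕ-res m = toℕ-fromℕ< (m%n<n m k)

    res-cong : ∀ m n → m % k ≡ n % k → res m ≡ res n
    res-cong m n eq = toℕ-injective (trans (toℕ-res m) (trans eq (sym (toℕ-res n))))

    res-toℕ : ∀ a → res (toℕ a) ≡ a
    res-toℕ a = toℕ-injective (trans (toℕ-res (toℕ a)) (m<n⇒m%n≡m (toℕ<n a)))

    _⊕_ : Fin k → Fin k → Fin k
    a ⊕ b = res (toℕ a + toℕ b)

    neg : Fin k → Fin k
    neg a = res (k ∸ toℕ a)

    res-+ : ∀ m n → res (m + n) ≡ res m ⊕ res n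
    res-+ m n = res-cong (m + n) (toℕ (res m) + toℕ (res n)) (begin
      (m + n) % k                              ≡⟨ %-distribˡ-+ m n k ⟩
      (m % k + n % k) % k                      ≡⟨ cong₂ (λ x y → (x + y) % k) (toℕ-res m) (toℕ-res n) ⟨
      (toℕ (res m) + toℕ (res n)) % k          ∎)
      where open ≡-Reasoning

    ⊕-comm : ∀ a b → a ⊕ b ≡ b ⊕ a
    ⊕-comm a b = cong res (+-comm (toℕ a) (toℕ b))

    ⊕-assoc : ∀ a b c → (a ⊕ b) ⊕ c ≡ a ⊕ (b ⊕ c)
    ⊕-assoc a b c = begin
      (a ⊕ b) ⊕ c                        ≡⟨ cong ((a ⊕ b) ⊕_) (res-toℕ c) ⟨
      res (toℕ a + toℕ b) ⊕ res (toℕ c)  ≡⟨ res-+ (toℕ a + toℕ b) (toℕ c) ⟨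
      res (toℕ a + toℕ b + toℕ c)        ≡⟨ cong res (+-assoc (toℕ a) (toℕ b) (toℕ c)) ⟩
      res (toℕ a + (toℕ b + toℕ c))      ≡⟨ res-+ (toℕ a) (toℕ b + toℕ c) ⟩
      res (toℕ a) ⊕ (b ⊕ c)              ≡⟨ cong (_⊕ (b ⊕ c)) (res-toℕ a) ⟩
      a ⊕ (b ⊕ c)                        ∎
      where open ≡-Reasoning

    ⊕-identityˡ : ∀ a → zero ⊕ a ≡ a
    ⊕-identityˡ = res-toℕ

    ⊕-identityʳ : ∀ a → a ⊕ zero ≡ a
    ⊕-identityʳ a = trans (⊕-comm a zero) (⊕-identityˡ a)

    -- The letter 1 is given by its value because k = 1 is still allowed here, and then no such
    -- letter exists. Serves to refute 1 = -1 when k ≥ 3.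
    one⊕one : ∀ {x} → toℕ x ≡ 1 → x ⊕ x ≡ res 2
    one⊕one eq = cong res (cong₂ _+_ eq eq)

    res-0 : res 0 ≡ zero
    res-0 = refl

    res-k : res k ≡ zero
    res-k = toℕ-injective (trans (toℕ-res k) (n%n≡0 k))

    res-k* : ∀ m → res (k * m) ≡ zero
    res-k* m = res-cong (k * m) 0 (trans (cong (_% k) (*-comm k m)) (m*n%n≡0 m k))

    ⊕-inverseʳ : ∀ a → a ⊕ neg a ≡ zero
    ⊕-inverseʳ a = begin
      a ⊕ neg a                      ≡⟨ cong (_⊕ neg a) (res-toℕ a) ⟨
      res (toℕ a) ⊕ res (k ∸ toℕ a)  ≡⟨ res-+ (toℕ a) (k ∸ toℕ a) ⟨
      res (toℕ a + (k ∸ toℕ a))      ≡⟨ cong res (m+[n∸m]≡n (<⇒≤ (toℕ<n a))) ⟩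
      res k                          ≡⟨ res-k ⟩
      zero                           ∎
      where open ≡-Reasoning

  ⊕-inverseˡ : ∀ a → neg a ⊕ a ≡ zero
  ⊕-inverseˡ a = trans (⊕-comm (neg a) a) (⊕-inverseʳ a)

  ⊕-group : Group _ _
  ⊕-group = record
    { Carrier = Fin k ; _≈_ = _≡_ ; _∙_ = _⊕_ ; ε = zero ; _⁻¹ = neg
    ; isGroup = record
      { isMonoid = record
        { isSemigroup = record
          { isMagma = record { isEquivalence = isEquivalence ; ∙-cong = cong₂ _⊕_ }
          ; assoc = ⊕-assoc }
        ; identity = ⊕-identityˡ , ⊕-identityʳ }
      ; inverse = ⊕-inverseˡ , ⊕-inverseʳ
      ; ⁻¹-cong = cong neg } }

  open GroupProperties ⊕-group public
    using () renaming (⁻¹-involutive to neg-involutive; ∙-cancelʳ to ⊕-cancelʳ;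
      ⁻¹-anti-homo-// to neg-⊖; //-rightDividesʳ to ⊕-⊖)

  _⊖_ : Fin k → Fin k → Fin k
  a ⊖ b = a ⊕ neg b

  iterate-⊕ : ∀ x a m → iterate (_⊕ x) a m ≡ a ⊕ res (m * toℕ x)
  iterate-⊕ x a zero    = sym (trans (cong (a ⊕_) res-0) (⊕-identityʳ a))
  iterate-⊕ x a (suc m) = begin
    iterate (_⊕ x) (a ⊕ x) m           ≡⟨ iterate-⊕ x (a ⊕ x) m ⟩
    (a ⊕ x) ⊕ res (m * toℕ x)          ≡⟨ ⊕-assoc a x _ ⟩
    a ⊕ (x ⊕ res (m * toℕ x))          ≡⟨ cong (λ y → a ⊕ (y ⊕ res (m * toℕ x))) (res-toℕ x) ⟨
    a ⊕ (res (toℕ x) ⊕ res (m * toℕ x)) ≡⟨ cong (a ⊕_) (res-+ (toℕ x) (m * toℕ x)) ⟨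
    a ⊕ res (toℕ x + m * toℕ x)         ∎
    where open ≡-Reasoning

  iterate-⊕-k : ∀ x a → iterate (_⊕ x) a k ≡ a
  iterate-⊕-k x a = trans (iterate-⊕ x a k) (trans (cong (a ⊕_) (res-k* (toℕ x))) (⊕-identityʳ a))

  star : List (Fin k) → List (Fin k)
  star d = reverse (map neg d)

  star-∷ : ∀ x t → star (x ∷ t) ≡ star t ∷ʳ neg x
  star-∷ x t = unfold-reverse (neg x) (map neg t)

  star-++ : ∀ x y → star (x ++ y) ≡ star y ++ star x
  star-++ x y = trans (cong reverse (map-++ neg x y)) (reverse-++ (map neg x) (map neg y))

  length-star : ∀ d → length (star d) ≡ length d
  length-star d = trans (length-reverse (map neg d)) (length-map neg d)

  star-involutive : ∀ d → star (star d) ≡ d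
  star-involutive d = begin
    reverse (map neg (reverse (map neg d)))  ≡⟨ cong reverse (reverse-map neg (map neg d)) ⟩
    reverse (reverse (map neg (map neg d)))  ≡⟨ reverse-involutive _ ⟩
    map neg (map neg d)                      ≡⟨ map-∘ d ⟨
    map (neg ∘ neg) d                        ≡⟨ map-cong neg-involutive d ⟩
    map (λ x → x) d                          ≡⟨ map-id d ⟩
    d                                        ∎
    where open ≡-Reasoning

  -- Reversal turns a left rotation of d into a right rotation of `star d`, which `rot` undoes.
  -- Hence `star` maps rotation classes to rotation classes.
  rot-star-rot : ∀ d → rot (star (rot d)) ≡ star d
  rot-star-rot []      = refl
  rot-star-rot (x ∷ t) = trans (cong rot (star-++ t (x ∷ []))) (sym (star-∷ x t))

-- Largest rotations and the choice between a word and its star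

module Chirality (k″ : ℕ) where

  open Cyclic (2 + k″) public

  one : Fin k
  one = suc zero

  -- Otherwise 2 = 1 + 1 = 0 in Z_k, although 2 < k.
  one≢neg-one : one ≢ neg one
  one≢neg-one eq = contradiction
    (trans (sym (m<n⇒m%n≡m 2<k)) (trans (sym (toℕ-res 2))
      (cong toℕ (trans (sym (one⊕one refl)) (trans (cong (_⊕ one) eq) (⊕-inverseˡ one)))))) λ ()
    where
    2<k : 2 < k
    2<k = s≤s (s≤s (s≤s z≤n))

  -- The shift by one keeps 0 free for -1, and k + 1 exceeds all shifted values, so the two extremes
  -- are fixed without losing injectivity.
  rank : Fin k → ℕ
  rank x with x Fin.≟ one | x Fin.≟ neg one
  ... | yes _ | _     = suc k
  ... | no _  | yes _ = 0
  ... | no _  | no _  = suc (toℕ x)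

  rank-one : rank one ≡ suc k
  rank-one with one Fin.≟ one
  ... | yes _ = refl
  ... | no ≢  = contradiction refl ≢

  rank-neg-one : rank (neg one) ≡ 0
  rank-neg-one with neg one Fin.≟ one | neg one Fin.≟ neg one
  ... | yes eq | _     = contradiction (sym eq) one≢neg-one
  ... | no _   | yes _ = refl
  ... | no _   | no ≢  = contradiction refl ≢

  rank≤ : ∀ x → rank x ≤ suc k
  rank≤ x with x Fin.≟ one | x Fin.≟ neg one
  ... | yes _ | _     = ≤-refl
  ... | no _  | yes _ = z≤n
  ... | no _  | no _  = s≤s (<⇒≤ (toℕ<n x))

  rank-injective : ∀ {x y} → rank x ≡ rank y → x ≡ y
  rank-injective {x} {y} eq
    with x Fin.≟ one | x Fin.≟ neg one | y Fin.≟ one | y Fin.≟ neg one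
  ... | yes p | _     | yes q | _     = trans p (sym q)
  ... | no _  | yes p | no _  | yes q = trans p (sym q)
  ... | no _  | no _  | no _  | no _  = toℕ-injective (suc-injective eq)
  ... | yes _ | _     | no _  | no _  = contradiction (sym (suc-injective eq)) (<⇒≢ (toℕ<n y))
  ... | no _  | no _  | yes _ | _     = contradiction (suc-injective eq) (<⇒≢ (toℕ<n x))

  base : ℕ
  base = 2 + k

  val : List (Fin k) → ℕ
  val []      = 0
  val (x ∷ t) = rank x + val t * base

  -- All ranks lie below `base`, so the remainder modulo `base` recovers the rank of the first
  -- letter and the quotient the rest of the word.
  val-injective : ∀ {d e} → length d ≡ length e → val d ≡ val e → d ≡ e
  val-injective {[]}    {[]}    _ _  = refl
  val-injective {x ∷ d} {y ∷ e} l eq = cong₂ _∷_ x≡y (val-injective (suc-injective l) vd≡ve)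
    where
    open ≡-Reasoning
    rank≡ : rank x ≡ rank y
    rank≡ = begin
      rank x                          ≡⟨ m<n⇒m%n≡m (s≤s (rank≤ x)) ⟨
      rank x % base                   ≡⟨ [m+kn]%n≡m%n (rank x) (val d) base ⟨
      (rank x + val d * base) % base  ≡⟨ cong (_% base) eq ⟩
      (rank y + val e * base) % base  ≡⟨ [m+kn]%n≡m%n (rank y) (val e) base ⟩
      rank y % base                   ≡⟨ m<n⇒m%n≡m (s≤s (rank≤ y)) ⟩
      rank y                          ∎
    x≡y : x ≡ y
    x≡y = rank-injective rank≡
    vd≡ve : val d ≡ val e
    vd≡ve = *-cancelʳ-≡ (val d) (val e) base (+-cancelˡ-≡ (rank x) _ _
      (trans eq (cong (_+ val e * base) (sym rank≡))))

  infix 4 _≼_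
  _≼_ : List (Fin k) → List (Fin k) → Set
  _≼_ = Pointwise (λ x y → rank x ≤ rank y)

  ≼-refl : ∀ {d} → d ≼ d
  ≼-refl = Pw.refl ≤-refl

  val-mono : ∀ {d e} → d ≼ e → val d ≤ val e
  val-mono []       = z≤n
  val-mono (r ∷ rs) = +-mono-≤ r (*-monoˡ-≤ base (val-mono rs))

  rotate-mono : ∀ i {d e} → d ≼ e → rotate i d ≼ rotate i e
  rotate-mono zero    rs       = rs
  rotate-mono (suc i) []       = rotate-mono i {[]} {[]} []
  rotate-mono (suc i) (r ∷ rs) = rotate-mono i (Pw.++⁺ rs (r ∷ []))

  -- val is injective, so maxRot determines the necklace (rotation class) of a word.
  abstract

    maxRot : List (Fin k) → ℕ
    maxRot d = maxUpTo (λ i → val (rotate i d)) (length d)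

    maxRot-attained : ∀ d → ∃ λ i → maxRot d ≡ val (rotate i d)
    maxRot-attained d = maxUpTo-attained (λ i → val (rotate i d)) (length d)

    -- Rotation by any i is rotation by the length of some prefix, which is within the range of the
    -- maximum.
    val-rotate≤maxRot : ∀ i d → val (rotate i d) ≤ maxRot d
    val-rotate≤maxRot i d with rotate-split i d
    ... | x , y , refl , r≡ = subst (λ w → val w ≤ maxRot d)
      (trans (rotate-++ x y) (sym r≡))
      (≤maxUpTo (λ i → val (rotate i d)) (length d) (length-++-≤ˡ x))

  maxRot-rotate≤ : ∀ i d → maxRot (rotate i d) ≤ maxRot d
  maxRot-rotate≤ i d with maxRot-attained (rotate i d)
  ... | j , eq = subst (_≤ maxRot d)
    (sym (trans eq (cong val (sym (iterate-+ rot d i j))))) (val-rotate≤maxRot (i + j) d)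

  maxRot-rotate : ∀ i d → maxRot (rotate i d) ≡ maxRot d
  maxRot-rotate i d with rotate-back i d
  ... | j , eq = ≤-antisym (maxRot-rotate≤ i d)
    (subst (λ w → maxRot w ≤ maxRot (rotate i d)) eq (maxRot-rotate≤ j (rotate i d)))

  maxRot-mono : ∀ {d e} → d ≼ e → maxRot d ≤ maxRot e
  maxRot-mono {d} {e} rs with maxRot-attained d
  ... | i , eq = ≤-trans (≤-reflexive eq)
    (≤-trans (val-mono (rotate-mono i rs)) (val-rotate≤maxRot i e))

  maxRot-star-rot : ∀ d → maxRot (star (rot d)) ≡ maxRot (star d)
  maxRot-star-rot d = trans (sym (maxRot-rotate 1 (star (rot d)))) (cong maxRot (rot-star-rot d))

  Chosen : List (Fin k) → Set
  Chosen d = maxRot (star d) < maxRot d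

  chosen-rot : ∀ {d} → Chosen d → Chosen (rot d)
  chosen-rot {d} = subst₂ _<_ (sym (maxRot-star-rot d)) (sym (maxRot-rotate 1 d))

  chosen-star : ∀ {d} → Chosen d → ¬ Chosen (star d)
  chosen-star {d} p q = <-asym p (subst (_< maxRot (star d)) (cong maxRot (star-involutive d)) q)

  -- one has the largest rank and neg one the smallest, so the change raises maxRot of the word
  -- and lowers that of its star.
  chosen-raise : ∀ t x → Chosen (t ∷ʳ x) → Chosen (t ∷ʳ one)
  chosen-raise t x p = ≤-trans (s≤s (maxRot-mono star≼)) (≤-trans p (maxRot-mono raise≼))
    where
    raise≼ : t ∷ʳ x ≼ t ∷ʳ one
    raise≼ = Pw.++⁺ ≼-refl (subst (rank x ≤_) (sym rank-one) (rank≤ x) ∷ [])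
    star≼ : star (t ∷ʳ one) ≼ star (t ∷ʳ x)
    star≼ = subst₂ _≼_ (sym (star-++ t (one ∷ []))) (sym (star-++ t (x ∷ [])))
      (subst (_≤ rank (neg x)) (sym rank-neg-one) z≤n ∷ ≼-refl)

  star-replicate : ∀ n x → star (replicate n x) ≡ replicate n (neg x)
  star-replicate zero    x = refl
  star-replicate (suc n) x = trans (star-∷ x (replicate n x))
    (trans (cong (_∷ʳ neg x) (star-replicate n x)) (replicate-∷ʳ n (neg x)))

  -- A constant word equals all its rotations. The star of the all-one word is constant -1 and has
  -- only digits 0, while positive length gives the all-one word a positive value.
  chosen-ones : ∀ n → Chosen (replicate (suc n) one)
  chosen-ones n = begin-strict
    maxRot (star (replicate (suc n) one))          ≡⟨ cong maxRot (star-replicate (suc n) one) ⟩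
    maxRot (replicate (suc n) (neg one))           ≡⟨ proj₂ (maxRot-attained (replicate (suc n) (neg one))) ⟩
    val (rotate i (replicate (suc n) (neg one)))   ≡⟨ cong val (rotate-replicate i (suc n) (neg one)) ⟩
    val (replicate (suc n) (neg one))              ≡⟨ val-neg-ones (suc n) ⟩
    0                                              <⟨ s≤s z≤n ⟩
    suc k                                          ≡⟨ rank-one ⟨
    rank one                                       ≤⟨ m≤m+n (rank one) _ ⟩
    val (replicate (suc n) one)                    ≤⟨ val-rotate≤maxRot 0 (replicate (suc n) one) ⟩
    maxRot (replicate (suc n) one)                 ∎
    where
    open ≤-Reasoning
    i : ℕ
    i = proj₁ (maxRot-attained (replicate (suc n) (neg one)))
    val-neg-ones : ∀ n → val (replicate n (neg one)) ≡ 0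
    val-neg-ones zero    = refl
    val-neg-ones (suc n) = cong₂ (λ r v → r + v * base) rank-neg-one (val-neg-ones n)

  -- `val` is injective on words of one length, so equal maxima mean that d and `star d` share a
  -- rotation. Hence d = y ++ x and `star d` = x ++ y for some x and y. But `star d` is also
  -- `star x ++ star y`, and comparing lengths makes both pieces fixed by `star`.
  achiral-split : ∀ d → maxRot d ≡ maxRot (star d) →
                  ∃₂ λ x y → d ≡ x ++ y × x ≡ star x × y ≡ star y
  achiral-split d eq with maxRot-attained d | maxRot-attained (star d)
  ... | i , eqᵢ | j , eqⱼ with rotate-back i d
  ... | i′ , back with rotate-split (j + i′) (star d)
  ... | x , y , star≡ , r≡ = y , x , d≡y++x , sym (proj₂ splits) , sym (proj₁ splits)
    where
    rotations≡ : rotate i d ≡ rotate j (star d)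
    rotations≡ = val-injective
      (trans (length-rotate i d) (sym (trans (length-rotate j (star d)) (length-star d))))
      (trans (sym eqᵢ) (trans eq eqⱼ))
    d≡y++x : d ≡ y ++ x
    d≡y++x = trans (sym back) (trans (cong (rotate i′) rotations≡)
      (trans (sym (iterate-+ rot (star d) j i′)) r≡))
    splits : star x ≡ x × star y ≡ y
    splits = ++-split {b = star y} (length-star x)
      (trans (sym (star-++ y x)) (trans (cong star (sym d≡y++x)) star≡))

-- The graph of chosen words: enumeration, trails and orbits of σ

least : ∀ {P : ℕ → Set} → Decidable P → ∀ m → P m → ∃ λ q → P q × (∀ {r} → r < q → ¬ P r)
least P? zero    p = 0 , p , λ ()
least {P} P? (suc m) p with P? 0
... | yes p₀ = 0 , p₀ , λ ()
... | no ¬p₀ with least (P? ∘ suc) m p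
... | q , pq , min = suc q , pq , min′
  where
  min′ : ∀ {r} → r < suc q → ¬ P r
  min′ {zero}  _         = ¬p₀
  min′ {suc r} (s≤s r<q) = min r<q

module Words (A : Set) (letters : List A) where

  words : ℕ → List (List A)
  words zero    = [] ∷ []
  words (suc n) = cartesianProductWith _∷_ letters (words n)

  ∈-words : (∀ a → a ∈ letters) → ∀ d → d ∈ words (length d)
  ∈-words all []      = here refl
  ∈-words all (x ∷ d) = ∈-cartesianProductWith⁺ _∷_ (all x) (∈-words all d)

module Tours (k″ n′ : ℕ) where

  open Chirality k″ public
  open Words (Fin k) (allFin k) public

  n : ℕ
  n = suc n′

  -- The edge (a , d) stands for the word of length n + 1 that starts with a and has the list d of
  -- successive differences.  A vertex is the same with one difference less; v and tgt e are the
  -- initial and final n letters of the word of an edge e with StartsAt e v.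
  Edge : Set
  Edge = Fin k × List (Fin k)

  _≟ₑ_ : (e f : Edge) → Dec (e ≡ f)
  _≟ₑ_ = ×-≡-dec Fin._≟_ (≡-dec Fin._≟_)

  open DecMembership _≟ₑ_ using (_∈?_)

  record Valid (e : Edge) : Set where
    constructor isValid
    field
      hasLength : length (proj₂ e) ≡ n
      isChosen  : Chosen (proj₂ e)

  valid? : ∀ e → Dec (Valid e)
  valid? (a , d) = map′ (uncurry isValid) (λ { (isValid l c) → l , c })
    ((length d ℕ.≟ n) ×-dec (maxRot (star d) <? maxRot d))

  tgt : Edge → Edge
  tgt (a , [])    = a , []
  tgt (a , x ∷ t) = a ⊕ x , t

  StartsAt : Edge → Edge → Set
  StartsAt e v = ∃ λ y → e ≡ (proj₁ v , proj₂ v ∷ʳ y)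

  Trail : Edge → List Edge → Edge → Set
  Trail v []      w = v ≡ w
  Trail v (e ∷ T) w = StartsAt e v × Trail (tgt e) T w

  trail-++ : ∀ {v w z} S {T} → Trail v S w → Trail w T z → Trail v (S ++ T) z
  trail-++ []      refl    t = t
  trail-++ (e ∷ S) (s , r) t = s , trail-++ S r t

  -- The splicing step of Hierholzer's algorithm: the closed trail C is run through right after w,
  -- at whose end it starts and finishes.
  trail-insert : ∀ {v z w} A {B C} → Trail v (A ++ w ∷ B) z → Trail (tgt w) C (tgt w) →
                 Trail v (A ++ w ∷ C ++ B) z
  trail-insert []      {C = C} (s , r) c = s , trail-++ C c r
  trail-insert (e ∷ A)         (s , r) c = s , trail-insert A r c

  -- The pure cycling successor: the difference that is dropped is appended again. As rotation
  -- preserves `Chosen`, this permutes the valid edges and splits them into closed trails.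
  σ : Edge → Edge
  σ (a , [])    = a , []
  σ (a , x ∷ t) = a ⊕ x , t ∷ʳ x

  -- The successor that appends the difference 1. From any valid edge, n such steps lead to the
  -- cycle of all-one differences, which yields connectedness.
  next : Edge → Edge
  next (a , [])    = a , []
  next (a , x ∷ t) = a ⊕ x , t ∷ʳ one

  valid-σ : ∀ {e} → Valid e → Valid (σ e)
  valid-σ {a , x ∷ t} (isValid l c) = isValid (trans (length-rot (x ∷ t)) l) (chosen-rot {x ∷ t} c)

  valid-next : ∀ {e} → Valid e → Valid (next e)
  valid-next {a , x ∷ t} (isValid l c) =
    isValid (trans (length-rot (one ∷ t)) l) (chosen-raise t x (chosen-rot {x ∷ t} c))

  σ-startsAt : ∀ {e} → Valid e → StartsAt (σ e) (tgt e)
  σ-startsAt {a , x ∷ t} _ = x , refl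

  -- The initial vertex can be read off an edge, so two edges followed by the same edge end at the
  -- same vertex.
  σ≡next⇒tgt≡ : ∀ {e f} → Valid e → Valid f → σ e ≡ next f → tgt e ≡ tgt f
  σ≡next⇒tgt≡ {b , z ∷ s} {a , x ∷ t} _ _ eq =
    cong₂ _,_ (cong proj₁ eq) (∷ʳ-injectiveˡ s t (cong proj₂ eq))

  sum : List (Fin k) → Fin k
  sum []      = zero
  sum (x ∷ d) = x ⊕ sum d

  iterate-σ-++ : ∀ a x y → iterate σ (a , x ++ y) (length x) ≡ (a ⊕ sum x , y ++ x)
  iterate-σ-++ a []      y = cong₂ _,_ (sym (⊕-identityʳ a)) (sym (++-identityʳ y))
  iterate-σ-++ a (c ∷ x) y = begin
    iterate σ (a ⊕ c , (x ++ y) ∷ʳ c) (length x)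
      ≡⟨ cong (λ d → iterate σ (a ⊕ c , d) (length x)) (++-assoc x y _) ⟩
    iterate σ (a ⊕ c , x ++ (y ∷ʳ c)) (length x)
      ≡⟨ iterate-σ-++ (a ⊕ c) x (y ∷ʳ c) ⟩
    (a ⊕ c ⊕ sum x , (y ∷ʳ c) ++ x)
      ≡⟨ cong₂ _,_ (⊕-assoc a c (sum x)) (++-assoc y _ x) ⟩
    (a ⊕ (c ⊕ sum x) , y ++ c ∷ x) ∎
    where open ≡-Reasoning

  -- One full turn restores the differences and advances the first letter by their sum. After k
  -- turns the letter is restored too, which bounds the order of σ.
  iterate-σ-length : ∀ a d m → iterate σ (a , d) (m * length d) ≡ (iterate (_⊕ sum d) a m , d)
  iterate-σ-length a d zero    = refl
  iterate-σ-length a d (suc m) = begin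
    iterate σ (a , d) (length d + m * length d)              ≡⟨ iterate-+ σ (a , d) (length d) _ ⟩
    iterate σ (iterate σ (a , d) (length d)) (m * length d)  ≡⟨ cong (λ e → iterate σ e (m * length d)) once ⟩
    iterate σ (a ⊕ sum d , d) (m * length d)                 ≡⟨ iterate-σ-length (a ⊕ sum d) d m ⟩
    (iterate (_⊕ sum d) (a ⊕ sum d) m , d)                   ∎
    where
    open ≡-Reasoning
    once : iterate σ (a , d) (length d) ≡ (a ⊕ sum d , d)
    once = subst (λ w → iterate σ (a , w) (length d) ≡ (a ⊕ sum d , d)) (++-identityʳ d) (iterate-σ-++ a d [])

  -- suc order-1 = k * n is a multiple of the order of σ on valid edges.
  order-1 : ℕ
  order-1 = n′ + (2 + k″) * n

  iterate-σ-order : ∀ {e} → Valid e → iterate σ e (suc order-1) ≡ e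
  iterate-σ-order {a , d} (isValid l _) = begin
    iterate σ (a , d) (k * n)                    ≡⟨ cong (λ m → iterate σ (a , d) (k * m)) l ⟨
    iterate σ (a , d) (k * length d)             ≡⟨ iterate-σ-length a d k ⟩
    (iterate (_⊕ sum d) a k , d)      ≡⟨ cong (_, d) (iterate-⊕-k _ a) ⟩
    (a , d)                                      ∎
    where open ≡-Reasoning

  -- The total `i + i * order-1` is a multiple of k n, so `i * order-1` further steps invert the
  -- first i steps.
  iterate-σ-return : ∀ {e} → Valid e → ∀ i → iterate σ (iterate σ e i) (i * order-1) ≡ e
  iterate-σ-return {e} v i = begin
    iterate σ (iterate σ e i) (i * order-1)   ≡⟨ iterate-+ σ e i _ ⟨
    iterate σ e (i + i * order-1)             ≡⟨ cong (iterate σ e) (*-suc i order-1) ⟨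
    iterate σ e (i * suc order-1)             ≡⟨ multiple i ⟩
    e                                         ∎
    where
    open ≡-Reasoning
    multiple : ∀ i → iterate σ e (i * suc order-1) ≡ e
    multiple zero    = refl
    multiple (suc i) = trans (iterate-+ σ e (suc order-1) _)
      (trans (cong (λ f → iterate σ f (i * suc order-1)) (iterate-σ-order v)) (multiple i))

  σ-iterate-cancel : ∀ {e f} → Valid e → Valid f → ∀ i → iterate σ e i ≡ iterate σ f i → e ≡ f
  σ-iterate-cancel ve vf i eq = trans (sym (iterate-σ-return ve i))
    (trans (cong (λ g → iterate σ g (i * order-1)) eq) (iterate-σ-return vf i))

  valid-iterate : ∀ {e} → Valid e → ∀ i → Valid (iterate σ e i)
  valid-iterate v i = iterate-closed Valid σ (λ {x} → valid-σ {x}) i v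

  -- Begins at `σ e` rather than e, so that a full period ends with e and the closed trail is based
  -- at `tgt e`, the vertex where it gets spliced in.
  walk : Edge → ℕ → List Edge
  walk e q = applyUpTo (λ i → iterate σ e (suc i)) q

  trail-walk : ∀ {e} q → Valid e → Trail (tgt e) (walk e q) (tgt (iterate σ e q))
  trail-walk     zero    v = refl
  trail-walk {e} (suc q) v = σ-startsAt v , trail-walk q (valid-σ {e} v)

  record Orbit (e : Edge) : Set where
    field
      edges    : List Edge
      unique   : Unique edges
      iterates : ∀ {f} → f ∈ edges → ∃ λ i → f ≡ iterate σ e i
      start    : e ∈ edges
      closed   : ∀ {f} → f ∈ edges → σ f ∈ edges
      trail    : Trail (tgt e) edges (tgt e)

  orbit : ∀ {e} → Valid e → Orbit e
  -- The offset by one excludes the trivial return after 0 steps: `suc q` is the exact period of e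
  -- under σ.
  orbit {e} v with least (λ i → iterate σ e (suc i) ≟ₑ e) order-1 (iterate-σ-order v)
  ... | q , returns , minimal = record
    { edges    = walk e (suc q)
    ; unique   = Unique.applyUpTo⁺₁ _ (suc q) distinct
    ; iterates = λ f∈ → let i , _ , eq = ∈-applyUpTo⁻ (λ i → iterate σ e (suc i)) f∈ in suc i , eq
    ; start    = e∈
    ; closed   = closed
    ; trail    = subst (λ f → Trail (tgt e) (walk e (suc q)) (tgt f)) returns (trail-walk (suc q) v)
    }
    where
    e∈ : e ∈ walk e (suc q)
    e∈ = subst (_∈ walk e (suc q)) returns (∈-applyUpTo⁺ (λ i → iterate σ e (suc i)) ≤-refl)
    distinct : ∀ {i j} → i < j → j < suc q → iterate σ e (suc i) ≢ iterate σ e (suc j)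
    -- Cancelling the first i + 1 steps would bring e back after j - i steps, fewer than `suc q`.
    distinct {i} {j} i<j j≤q eq = minimal {j ∸ suc i} (<-≤-trans (∸-monoʳ-< {j} (s≤s z≤n) i<j) (s≤s⁻¹ j≤q))
      (sym (σ-iterate-cancel v (valid-iterate v (suc (j ∸ suc i))) (suc i) (begin
        iterate σ e (suc i)                                      ≡⟨ eq ⟩
        iterate σ e (suc j)                                      ≡⟨ cong (iterate σ e ∘ suc) (m∸n+n≡m i<j) ⟨
        iterate σ e (suc (j ∸ suc i) + suc i)                    ≡⟨ iterate-+ σ e (suc (j ∸ suc i)) (suc i) ⟩
        iterate σ (iterate σ e (suc (j ∸ suc i))) (suc i)        ∎)))
      where open ≡-Reasoning
    closed : ∀ {f} → f ∈ walk e (suc q) → σ f ∈ walk e (suc q)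
    closed f∈ with ∈-applyUpTo⁻ (λ i → iterate σ e (suc i)) f∈
    ... | i , i<1+q , refl with m≤n⇒m<n∨m≡n (s≤s⁻¹ i<1+q)
    ... | inj₁ i<q = subst (_∈ walk e (suc q)) (iterate-outer σ e (suc i))
                       (∈-applyUpTo⁺ (λ i → iterate σ e (suc i)) (s≤s i<q))
    -- At the last position f is e, and its successor is the head of the list.
    ... | inj₂ refl = subst (λ f → σ f ∈ walk e (suc q)) (sym returns) (here refl)

  -- Gluing the orbits into one Euler tour

  ones : List (Fin k)
  ones = replicate n one

  root : Edge
  root = zero , ones

  -- `closed` makes the trail a union of whole σ-orbits, so an orbit with a missing edge is disjoint
  -- from it. `roots` supplies the cycle that every chain of `next` steps reaches.
  record Tour : Set where
    field
      edges  : List Edge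
      unique : Unique edges
      valid  : ∀ {e} → e ∈ edges → Valid e
      closed : ∀ {e} → e ∈ edges → σ e ∈ edges
      roots  : ∀ b → (b , ones) ∈ edges
      trail  : Trail (tgt root) edges (tgt root)

  open Tour

  infix 4 _⊑_
  _⊑_ : Tour → Tour → Set
  S ⊑ T = ∀ {e} → e ∈ edges S → e ∈ edges T

  valid-root : Valid root
  valid-root = isValid (length-replicate n) (chosen-ones n′)

  -- On all-one differences σ only adds 1 to the first letter, so the orbit of `root` runs through
  -- all k letters.
  rootTour : Tour
  rootTour = record
    { edges  = O.edges
    ; unique = O.unique
    ; valid  = λ f∈ → let i , eq = O.iterates f∈ in subst Valid (sym eq) (valid-iterate valid-root i)
    ; closed = O.closed
    ; roots  = λ b → subst (_∈ O.edges) (reaches b)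
                 (iterate-closed (_∈ O.edges) σ O.closed (toℕ b) O.start)
    ; trail  = O.trail
    }
    where
    module O = Orbit (orbit valid-root)
    iterate-σ-ones : ∀ a m → iterate σ (a , ones) m ≡ (iterate (_⊕ one) a m , ones)
    iterate-σ-ones a zero    = refl
    iterate-σ-ones a (suc m) = trans
      (cong (λ d → iterate σ (a ⊕ one , d) m) (replicate-∷ʳ n′ one))
      (iterate-σ-ones (a ⊕ one) m)
    reaches : ∀ b → iterate σ root (toℕ b) ≡ (b , ones)
    reaches b = trans (iterate-σ-ones zero (toℕ b)) (cong (_, ones) (begin
      iterate (_⊕ one) zero (toℕ b)  ≡⟨ iterate-⊕ one zero (toℕ b) ⟩
      zero ⊕ res (toℕ b * 1)         ≡⟨ ⊕-identityˡ _ ⟩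
      res (toℕ b * 1)                ≡⟨ cong res (*-identityʳ (toℕ b)) ⟩
      res (toℕ b)                    ≡⟨ res-toℕ b ⟩
      b                              ∎))
      where open ≡-Reasoning

  insertOrbit : ∀ T {w u} → w ∈ edges T → Valid u → u ∉ edges T → tgt w ≡ tgt u →
                ∃ λ T′ → T ⊑ T′ × u ∈ edges T′
  insertOrbit T {w} {u} w∈ v u∉ tgt≡ with ∈-∃++ w∈
  ... | A , B , edges≡ = T′ , ∈ʳ , ∈ˡ O.start
    where
    module O = Orbit (orbit v)
    E : List Edge
    E = A ++ w ∷ O.edges ++ B
    -- The spliced trail rearranges the orbit and the old trail; distinctness and membership are
    -- carried over from their concatenation.
    perm : O.edges ++ edges T ↭ E
    perm = subst₂ _↭_
      (cong (O.edges ++_) (trans (++-assoc A (w ∷ []) B) (sym edges≡)))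
      (++-assoc A (w ∷ []) (O.edges ++ B)) (↭-sym (shifts (A ∷ʳ w) O.edges {B}))
    ∈ˡ : ∀ {e} → e ∈ O.edges → e ∈ E
    ∈ˡ e∈ = ∈-resp-↭ perm (∈-++⁺ˡ e∈)
    ∈ʳ : ∀ {e} → e ∈ edges T → e ∈ E
    ∈ʳ e∈ = ∈-resp-↭ perm (∈-++⁺ʳ O.edges e∈)
    ∈-E⁻ : ∀ {e} → e ∈ E → e ∈ O.edges ⊎ e ∈ edges T
    ∈-E⁻ e∈ = ∈-++⁻ O.edges (∈-resp-↭ (↭-sym perm) e∈)
    -- The old trail is closed under σ, so from a common edge it would follow the orbit round to u
    -- itself.
    disjoint : ∀ {e} → e ∈ O.edges × e ∈ edges T → _
    disjoint (e∈O , e∈T) with O.iterates e∈O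
    ... | i , refl = u∉ (subst (_∈ edges T) (iterate-σ-return v i)
      (iterate-closed (_∈ edges T) σ (closed T) (i * order-1) e∈T))
    T′ : Tour
    T′ = record
      { edges  = E
      ; unique = ↭ₛ.Unique-resp-↭ (setoid Edge) (↭⇒↭ₛ perm) (Unique.++⁺ O.unique (unique T) disjoint)
      ; valid  = λ e∈ → valid′ (∈-E⁻ e∈)
      ; closed = λ e∈ → closed′ (∈-E⁻ e∈)
      ; roots  = λ b → ∈ʳ (roots T b)
      ; trail  = trail-insert A (subst (λ L → Trail (tgt root) L (tgt root)) edges≡ (trail T))
                   (subst (λ z → Trail z O.edges z) (sym tgt≡) O.trail)
      }
      where
      valid′ : ∀ {e} → e ∈ O.edges ⊎ e ∈ edges T → Valid e
      valid′ (inj₁ e∈) with O.iterates e∈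
      ... | i , refl = valid-iterate v i
      valid′ (inj₂ e∈) = valid T e∈
      closed′ : ∀ {e} → e ∈ O.edges ⊎ e ∈ edges T → σ e ∈ E
      closed′ (inj₁ e∈) = ∈ˡ (O.closed e∈)
      closed′ (inj₂ e∈) = ∈ʳ (closed T e∈)

  -- Induction on the number of `next` steps from u to an all-one edge. Once `next u` is on the
  -- tour, so is its σ-predecessor w by closure. Both w and u precede `next u`, hence share their
  -- target, and the orbit of u can be spliced in after w.
  extend : ∀ m {u b} → Valid u → iterate next u m ≡ (b , ones) → ∀ T →
           ∃ λ T′ → T ⊑ T′ × u ∈ edges T′
  extend zero        v refl T = T , id , roots T _
  extend (suc m) {u} v eq   T with extend m (valid-next {u} v) eq T
  ... | T₁ , T⊑T₁ , next∈ with u ∈? edges T₁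
  ... | yes u∈ = T₁ , T⊑T₁ , u∈
  ... | no u∉ with insertOrbit T₁ w∈ v u∉ (σ≡next⇒tgt≡ (valid T₁ w∈) v σw≡)
    where
    w : Edge
    -- On valid edges `order-1` steps of σ undo one step.
    w = iterate σ (next u) order-1
    w∈ : w ∈ edges T₁
    w∈ = iterate-closed (_∈ edges T₁) σ (closed T₁) order-1 next∈
    σw≡ : σ w ≡ next u
    σw≡ = trans (sym (iterate-outer σ (next u) order-1)) (iterate-σ-order (valid-next {u} v))
  ... | T₂ , T₁⊑T₂ , u∈ = T₂ , T₁⊑T₂ ∘ T⊑T₁ , u∈

  -- Each step discards the first difference and appends a 1; when x is the whole word only ones
  -- remain.
  iterate-next : ∀ a x y → ∃ λ b → iterate next (a , x ++ y) (length x) ≡ (b , y ++ replicate (length x) one)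
  iterate-next a []      y = a , cong (a ,_) (sym (++-identityʳ y))
  iterate-next a (c ∷ x) y with iterate-next (a ⊕ c) x (y ∷ʳ one)
  ... | b , eq = b , trans
    (cong (λ d → iterate next (a ⊕ c , d) (length x)) (++-assoc x y _))
    (trans eq (cong (b ,_) (++-assoc y _ _)))

  iterate-next-ones : ∀ {e} → Valid e → ∃ λ b → iterate next e n ≡ (b , ones)
  iterate-next-ones {a , d} (isValid l _) with iterate-next a d []
  ... | b , eq = b , subst₂ (λ w m → iterate next (a , w) m ≡ (b , replicate m one)) (++-identityʳ d) l eq

  extendAll : ∀ us T → ∃ λ T′ → T ⊑ T′ × (∀ {u} → u ∈ us → Valid u → u ∈ edges T′)
  extendAll []       T = T , id , λ ()
  extendAll (u ∷ us) T with extendAll us T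
  ... | T₁ , T⊑T₁ , all₁ with valid? u
  ... | no ¬v = T₁ , T⊑T₁ , λ { (here refl) v → contradiction v ¬v ; (there u∈) v → all₁ u∈ v }
  ... | yes v with extend n v (proj₂ (iterate-next-ones v)) T₁
  ... | T₂ , T₁⊑T₂ , u∈₂ = T₂ , T₁⊑T₂ ∘ T⊑T₁ ,
    λ { (here refl) _ → u∈₂ ; (there u∈) v → T₁⊑T₂ (all₁ u∈ v) }

  eulerTour : ∃ λ T → ∀ {e} → Valid e → e ∈ edges T
  eulerTour with extendAll (cartesianProduct (allFin k) (words n)) rootTour
  ... | T , _ , all = T , λ { {a , d} v@(isValid l _) → all
    (∈-cartesianProduct⁺ (∈-allFin a) (subst (λ m → d ∈ words m) l (∈-words ∈-allFin d))) v }

-- The orientable sequence read off a tour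

%-≡-shift : ∀ i j p .{{_ : NonZero p}} → i % p ≡ j % p → i / p ≤ j / p → i + (j / p ∸ i / p) * p ≡ j
%-≡-shift i j p eq i≤j = begin
  i + (j / p ∸ i / p) * p                      ≡⟨ cong (_+ (j / p ∸ i / p) * p) (m≡m%n+[m/n]*n i p) ⟩
  i % p + (i / p) * p + (j / p ∸ i / p) * p    ≡⟨ +-assoc (i % p) _ _ ⟩
  i % p + ((i / p) * p + (j / p ∸ i / p) * p)  ≡⟨ cong (λ m → i % p + m) (*-distribʳ-+ p (i / p) _) ⟨
  i % p + (i / p + (j / p ∸ i / p)) * p        ≡⟨ cong₂ (λ r q → r + q * p) eq (m+[n∸m]≡n i≤j) ⟩
  j % p + (j / p) * p                          ≡⟨ m≡m%n+[m/n]*n j p ⟨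
  j                                            ∎
  where open ≡-Reasoning

%-≡⇒CongMod : ∀ i j p .{{_ : NonZero p}} → i % p ≡ j % p → CongMod i j p
%-≡⇒CongMod i j p eq with ≤-total (i / p) (j / p)
... | inj₁ i≤j = j / p ∸ i / p , inj₁ (%-≡-shift i j p eq i≤j)
... | inj₂ j≤i = i / p ∸ j / p , inj₂ (%-≡-shift j i p (sym eq) j≤i)

take-++ˡ : ∀ {A : Set} m (u v : List A) → m ≤ length u → take m (u ++ v) ≡ take m u
take-++ˡ zero    u       v _         = refl
take-++ˡ (suc m) (x ∷ u) v (s≤s m≤u) = cong (x ∷_) (take-++ˡ m u v m≤u)

module Sequence (k″ n′ : ℕ) (T : Tours.Tour k″ n′) where

  open Tours k″ n′
  open Tour T

  p : ℕ
  p = length edges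

  instance
    p-nonZero : NonZero p
    p-nonZero = nonEmpty (roots zero)
      where
      nonEmpty : ∀ {e} {E : List Edge} → e ∈ E → NonZero (length E)
      nonEmpty {E = _ ∷ _} _ = _

  trail-first : ∀ {v w} E → Trail v E w → ∀ j → toℕ j ≡ 0 → StartsAt (lookup E j) v
  trail-first (e ∷ E) (s , _) zero _ = s

  trail-step : ∀ {v w} E → Trail v E w → ∀ i j → toℕ j ≡ suc (toℕ i) →
               StartsAt (lookup E j) (tgt (lookup E i))
  trail-step (e ∷ E) (_ , r) zero    (suc j) eq = trail-first E r j (suc-injective eq)
  trail-step (e ∷ E) (_ , r) (suc i) (suc j) eq = trail-step E r i j (suc-injective eq)

  trail-last : ∀ {v w} E → Trail v E w → ∀ i → suc (toℕ i) ≡ length E → tgt (lookup E i) ≡ w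
  trail-last (e ∷ [])     (_ , r) zero    _  = r
  trail-last (e ∷ E@(_ ∷ _)) (_ , r) (suc i) eq = trail-last E r i (suc-injective eq)

  edge : ℕ → Edge
  edge i = lookup edges (i mod p)

  toℕ-mod : ∀ i → toℕ (i mod p) ≡ i % p
  toℕ-mod i = toℕ-fromℕ< (m%n<n i p)

  suc-% : ∀ i → suc i % p ≡ suc (i % p) % p
  suc-% i = trans (cong (λ m → suc m % p) (m≡m%n+[m/n]*n i p)) ([m+kn]%n≡m%n (suc (i % p)) (i / p) p)

  -- Consecutive positions follow the trail. After the last position the index wraps to 0, and the
  -- trail fits there because it begins and ends at `tgt root`.
  edge-step : ∀ i → StartsAt (edge (suc i)) (tgt (edge i))
  edge-step i with m≤n⇒m<n∨m≡n (m%n<n i p)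
  ... | inj₁ lt = trail-step edges trail (i mod p) (suc i mod p) (begin
      toℕ (suc i mod p)    ≡⟨ toℕ-mod (suc i) ⟩
      suc i % p            ≡⟨ suc-% i ⟩
      suc (i % p) % p      ≡⟨ m<n⇒m%n≡m lt ⟩
      suc (i % p)          ≡⟨ cong suc (toℕ-mod i) ⟨
      suc (toℕ (i mod p))  ∎)
    where open ≡-Reasoning
  ... | inj₂ eq = subst (StartsAt (edge (suc i)))
      (sym (trail-last edges trail (i mod p) (trans (cong suc (toℕ-mod i)) eq)))
      (trail-first edges trail (suc i mod p) (begin
        toℕ (suc i mod p)  ≡⟨ toℕ-mod (suc i) ⟩
        suc i % p          ≡⟨ suc-% i ⟩
        suc (i % p) % p    ≡⟨ cong (_% p) eq ⟩
        p % p              ≡⟨ n%n≡0 p ⟩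
        0                  ∎))
    where open ≡-Reasoning

  edge-valid : ∀ i → Valid (edge i)
  edge-valid i = valid (∈-lookup (i mod p))

  seq : ℕ → Fin k
  seq i = proj₁ (edge i)

  diffs : ℕ → ℕ → List (Fin k)
  diffs i zero    = []
  diffs i (suc m) = (seq (suc i) ⊖ seq i) ∷ diffs (suc i) m

  -- Induction on m: the first difference of `edge i` leads to the first letter of `edge (suc i)`,
  -- which carries the other differences of `edge i` followed by one new one. The bound on m keeps
  -- the new one out of reach.
  take-edge : ∀ m i → m ≤ n → take m (proj₂ (edge i)) ≡ diffs i m
  take-edge zero    i _ = refl
  take-edge (suc m) i m<n
    with edge i | edge-step i | Valid.hasLength (edge-valid i) | take-edge m (suc i) (<⇒≤ m<n)
  ... | a , x ∷ u | y , step | l | ih rewrite step = cong₂ _∷_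
    (sym (trans (cong (_⊖ a) (⊕-comm a x)) (⊕-⊖ a x)))
    (trans (sym (take-++ˡ m u (y ∷ []) (s≤s⁻¹ (subst (suc m ≤_) (sym l) m<n)))) ih)

  edge≡ : ∀ i → edge i ≡ (seq i , diffs i n)
  edge≡ i = cong (seq i ,_) (trans
    (sym (take-all n _ (≤-reflexive (Valid.hasLength (edge-valid i))))) (take-edge n i ≤-refl))

  sameWindow-diffs : ∀ m i j → SameWindow seq (suc m) i j → diffs i m ≡ diffs j m
  sameWindow-diffs zero    i j same = refl
  sameWindow-diffs (suc m) i j same = cong₂ _∷_
    (cong₂ _⊖_ (trans (cong seq (+-comm 1 i)) (trans (same 1 (s≤s (s≤s z≤n))) (cong seq (+-comm j 1))))
      (trans (cong seq (sym (+-identityʳ i))) (trans (same 0 (s≤s z≤n)) (cong seq (+-identityʳ j)))))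
    (sameWindow-diffs m (suc i) (suc j) λ r r< →
      trans (cong seq (sym (+-suc i r))) (trans (same (suc r) (s≤s r<)) (cong seq (+-suc j r))))

  diffs-∷ʳ : ∀ m i → diffs i (suc m) ≡ diffs i m ∷ʳ (seq (suc (i + m)) ⊖ seq (i + m))
  diffs-∷ʳ zero    i rewrite +-identityʳ i = refl
  diffs-∷ʳ (suc m) i = cong ((seq (suc i) ⊖ seq i) ∷_) (trans (diffs-∷ʳ m (suc i))
    (cong (λ l → diffs (suc i) m ∷ʳ (seq (suc l) ⊖ seq l)) (sym (+-suc i m))))

  -- Reading backwards reverses the differences and changes their signs. The induction removes the
  -- last letter of the window at i and the first letter of the window at j.
  reverseWindow-diffs : ∀ m i j → ReverseWindow seq (suc m) i j → diffs i m ≡ star (diffs j m)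
  reverseWindow-diffs zero    i j rev = refl
  reverseWindow-diffs (suc m) i j rev = begin
    diffs i (suc m)
      ≡⟨ diffs-∷ʳ m i ⟩
    diffs i m ∷ʳ (seq (suc (i + m)) ⊖ seq (i + m))
      ≡⟨ cong₂ (λ d x → d ∷ʳ x) (reverseWindow-diffs m i (suc j) rev′) last≡ ⟩
    star (diffs (suc j) m) ∷ʳ neg (seq (suc j) ⊖ seq j)
      ≡⟨ star-∷ (seq (suc j) ⊖ seq j) (diffs (suc j) m) ⟨
    star (diffs j (suc m)) ∎
    where
    open ≡-Reasoning
    rev′ : ReverseWindow seq (suc m) i (suc j)
    rev′ r r<1+m = trans (rev r (m<n⇒m<1+n r<1+m))
      (cong seq (trans (cong (λ r → j + r) (+-∸-assoc 1 (s≤s⁻¹ r<1+m))) (+-suc j (m ∸ r))))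
    last≡ : seq (suc (i + m)) ⊖ seq (i + m) ≡ neg (seq (suc j) ⊖ seq j)
    last≡ = trans
      (cong₂ _⊖_
        (trans (cong seq (sym (+-suc i m))) (trans (rev (suc m) ≤-refl)
          (cong seq (trans (cong (λ r → j + r) (n∸n≡0 m)) (+-identityʳ j)))))
        (trans (rev m (s≤s (n≤1+n m)))
          (cong seq (trans (cong (λ r → j + r) (m+n∸n≡m 1 m)) (+-comm j 1)))))
      (sym (neg-⊖ (seq (suc j)) (seq j)))

  sameWindow⇒%≡ : ∀ i j → SameWindow seq (suc n) i j → i % p ≡ j % p
  sameWindow⇒%≡ i j same = trans (sym (toℕ-mod i)) (trans (cong toℕ (lookup-injective unique edges≡)) (toℕ-mod j))
    where
    seq≡ : seq i ≡ seq j
    seq≡ = trans (cong seq (sym (+-identityʳ i))) (trans (same 0 (s≤s z≤n)) (cong seq (+-identityʳ j)))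
    edges≡ : edge i ≡ edge j
    edges≡ = trans (edge≡ i) (trans (cong₂ _,_ seq≡ (sameWindow-diffs n i j same)) (sym (edge≡ j)))

  seq-hasPeriod : HasPeriod seq p
  seq-hasPeriod = >-nonZero⁻¹ p , (λ i → cong (λ m → proj₁ (lookup edges m)) (toℕ-injective (begin
      toℕ ((i + p) mod p)  ≡⟨ toℕ-mod (i + p) ⟩
      (i + p) % p          ≡⟨ [m+n]%n≡m%n i p ⟩
      i % p                ≡⟨ toℕ-mod i ⟨
      toℕ (i mod p)        ∎))) ,
    -- A shorter period q would give equal windows at 0 and q, hence q = 0 modulo p.
    λ q 0<q q<p period → <⇒≢ 0<q (trans (sym (m<n⇒m%n≡m (>-nonZero⁻¹ p)))
      (trans (sameWindow⇒%≡ 0 q λ r _ → trans (sym (period r)) (cong seq (+-comm r q)))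
        (m<n⇒m%n≡m q<p)))
    where open ≡-Reasoning

  -- A window equal to a reversed window would make a chosen word the star of a chosen word.
  seq-orientable : IsOrientable seq p (suc n)
  seq-orientable = (seq-hasPeriod , λ i j same → %-≡⇒CongMod i j p (sameWindow⇒%≡ i j same)) ,
    λ i j rev → chosen-star (diffsChosen j)
      (subst Chosen (reverseWindow-diffs n i j rev) (diffsChosen i))
    where
    diffsChosen : ∀ i → Chosen (diffs i n)
    diffsChosen i = subst (Chosen ∘ proj₂) (edge≡ i) (Valid.isChosen (edge-valid i))

-- Counting achiral words and the length of the Euler tour

length-cartesianProductWith : ∀ {A B C : Set} (f : A → B → C) xs ys →
                              length (cartesianProductWith f xs ys) ≡ length xs * length ys
length-cartesianProductWith f []       ys = refl
length-cartesianProductWith f (x ∷ xs) ys = trans (length-++ (map (f x) ys))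
  (cong₂ _+_ (length-map (f x) ys) (length-cartesianProductWith f xs ys))

length-concatMap≤ : ∀ {A B : Set} (f : A → List B) b xs → (∀ {x} → x ∈ xs → length (f x) ≤ b) →
                    length (concatMap f xs) ≤ length xs * b
length-concatMap≤ f b []       _ = z≤n
length-concatMap≤ f b (x ∷ xs) h = ≤-trans (≤-reflexive (length-++ (f x)))
  (+-mono-≤ (h (here refl)) (length-concatMap≤ f b xs (h ∘ there)))

-- Each ceiling adds at most one half. This bounds the number of free letters in a concatenation of
-- two words fixed by `star`.
⌈m/2⌉+⌈n/2⌉≤1+⌊m+n/2⌋ : ∀ m n → ⌈ m /2⌉ + ⌈ n /2⌉ ≤ suc ⌊ m + n /2⌋
⌈m/2⌉+⌈n/2⌉≤1+⌊m+n/2⌋ zero          n = ⌊n/2⌋-mono (n≤1+n (suc n))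
⌈m/2⌉+⌈n/2⌉≤1+⌊m+n/2⌋ (suc zero)    n = ≤-refl
⌈m/2⌉+⌈n/2⌉≤1+⌊m+n/2⌋ (suc (suc m)) n = s≤s (⌈m/2⌉+⌈n/2⌉≤1+⌊m+n/2⌋ m n)

module Counting (k″ n′ : ℕ) where

  open Tours k″ n′

  length-letters : length (allFin k) ≡ k
  length-letters = length-tabulate {n = k} id

  length-words : ∀ m → length (words m) ≡ k ^ m
  length-words zero    = refl
  length-words (suc m) = trans (length-cartesianProductWith _∷_ (allFin k) (words m))
    (cong₂ _*_ length-letters (length-words m))

  unique-words : ∀ m → Unique (words m)
  unique-words zero    = [] ∷ []
  unique-words (suc m) = Unique.cartesianProductWith⁺ _∷_ ∷-injective (Unique.allFin⁺ k) (unique-words m)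

  word-length : ∀ m {d} → d ∈ words m → length d ≡ m
  word-length zero    (here refl) = refl
  word-length (suc m) d∈ with ∈-cartesianProductWith⁻ _∷_ (allFin k) (words m) d∈
  ... | _ , _ , _ , d∈′ , refl = cong suc (word-length m d∈′)

  -- Listed by the first ⌈m/2⌉ letters. For odd m the middle letter is the negated last letter of z
  -- and need not be its own negative, so words not fixed by `star` may occur; for an upper bound it
  -- is enough that all fixed words are present.
  starFixed : ℕ → List (List (Fin k))
  starFixed m = map (λ z → take ⌊ m /2⌋ z ++ star z) (words ⌈ m /2⌉)

  -- Let m be the length and cut x into u and v after ⌈m/2⌉ letters. Then x = `star x` =
  -- `star v ++ star u`, so `star v`, of length ⌊m/2⌋, is the start of x and hence of u.
  ∈-starFixed : ∀ x → x ≡ star x → x ∈ starFixed (length x)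
  ∈-starFixed x x≡ = subst (_∈ starFixed (length x)) (sym x≡u++)
    (∈-map⁺ (λ z → take ⌊ length x /2⌋ z ++ star z) (subst (λ m → u ∈ words m) length-u (∈-words ∈-allFin u)))
    where
    open ≡-Reasoning
    u v : List (Fin k)
    u = take ⌈ length x /2⌉ x
    v = drop ⌈ length x /2⌉ x
    length-u : length u ≡ ⌈ length x /2⌉
    length-u = trans (length-take ⌈ length x /2⌉ x) (m≤n⇒m⊓n≡m (⌈n/2⌉≤n (length x)))
    length-v : length (star v) ≡ ⌊ length x /2⌋
    length-v = begin
      length (star v)                            ≡⟨ length-star v ⟩
      length v                                   ≡⟨ length-drop ⌈ length x /2⌉ x ⟩
      length x ∸ ⌈ length x /2⌉                  ≡⟨ cong (_∸ ⌈ length x /2⌉) (⌊n/2⌋+⌈n/2⌉≡n (length x)) ⟨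
      ⌊ length x /2⌋ + ⌈ length x /2⌉ ∸ ⌈ length x /2⌉  ≡⟨ m+n∸n≡m _ ⌈ length x /2⌉ ⟩
      ⌊ length x /2⌋                             ∎
    x≡star : x ≡ star v ++ star u
    x≡star = trans x≡ (trans (cong star (sym (take++drop≡id ⌈ length x /2⌉ x))) (star-++ u v))
    take-u : take ⌊ length x /2⌋ u ≡ star v
    take-u = begin
      take ⌊ length x /2⌋ u
        ≡⟨ take-++ˡ _ u v (subst (⌊ length x /2⌋ ≤_) (sym length-u) (⌊n/2⌋≤⌈n/2⌉ (length x))) ⟨
      take ⌊ length x /2⌋ (u ++ v)
        ≡⟨ cong₂ take (sym length-v) (trans (take++drop≡id ⌈ length x /2⌉ x) x≡star) ⟩
      take (length (star v)) (star v ++ star u) ≡⟨ take-++ˡ _ (star v) (star u) ≤-refl ⟩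
      take (length (star v)) (star v)           ≡⟨ take-all _ (star v) ≤-refl ⟩
      star v                                    ∎
    x≡u++ : x ≡ take ⌊ length x /2⌋ u ++ star u
    x≡u++ = trans x≡star (cong (_++ star u) (sym take-u))

  starFixedPairs : ℕ → List (List (Fin k))
  starFixedPairs j = cartesianProductWith _++_ (starFixed j) (starFixed (n ∸ j))

  achiral : List (List (Fin k))
  achiral = concatMap starFixedPairs (upTo (suc n))

  ∈-achiral : ∀ d → length d ≡ n → maxRot d ≡ maxRot (star d) → d ∈ achiral
  ∈-achiral d l eq with achiral-split d eq
  ... | x , y , refl , x≡ , y≡ = ∈-concatMap⁺ starFixedPairs (lose (∈-upTo⁺ (s≤s lx≤n))
      (∈-cartesianProductWith⁺ _++_ (∈-starFixed x x≡)
        (subst (λ m → y ∈ starFixed m) ly (∈-starFixed y y≡))))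
    where
    lx+ly : length x + length y ≡ n
    lx+ly = trans (sym (length-++ x)) l
    lx≤n : length x ≤ n
    lx≤n = subst (length x ≤_) lx+ly (m≤m+n (length x) (length y))
    ly : length y ≡ n ∸ length x
    ly = sym (trans (cong (_∸ length x) (sym lx+ly)) (m+n∸m≡n (length x) (length y)))

  -- There are n + 1 cutting points, and for each of them the two parts together have at most ⌊n/2⌋
  -- + 1 free letters.
  length-achiral≤ : length achiral ≤ suc n * k ^ suc ⌊ n /2⌋
  length-achiral≤ = subst (λ m → length achiral ≤ m * k ^ suc ⌊ n /2⌋) (length-upTo (suc n))
    (length-concatMap≤ starFixedPairs (k ^ suc ⌊ n /2⌋) (upTo (suc n)) λ j∈ → bound _ (s≤s⁻¹ (∈-upTo⁻ j∈)))
    where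
    open ≤-Reasoning
    length-starFixed : ∀ m → length (starFixed m) ≡ k ^ ⌈ m /2⌉
    length-starFixed m = trans (length-map _ (words ⌈ m /2⌉)) (length-words ⌈ m /2⌉)
    bound : ∀ j → j ≤ n → length (starFixedPairs j) ≤ k ^ suc ⌊ n /2⌋
    bound j j≤n = begin
      length (cartesianProductWith _++_ (starFixed j) (starFixed (n ∸ j)))
        ≡⟨ length-cartesianProductWith _++_ (starFixed j) (starFixed (n ∸ j)) ⟩
      length (starFixed j) * length (starFixed (n ∸ j))
        ≡⟨ cong₂ _*_ (length-starFixed j) (length-starFixed (n ∸ j)) ⟩
      k ^ ⌈ j /2⌉ * k ^ ⌈ n ∸ j /2⌉
        ≡⟨ ^-distribˡ-+-* k ⌈ j /2⌉ ⌈ n ∸ j /2⌉ ⟨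
      k ^ (⌈ j /2⌉ + ⌈ n ∸ j /2⌉)
        ≤⟨ ^-monoʳ-≤ k (⌈m/2⌉+⌈n/2⌉≤1+⌊m+n/2⌋ j (n ∸ j)) ⟩
      k ^ suc ⌊ j + (n ∸ j) /2⌋
        ≡⟨ cong (λ m → k ^ suc ⌊ m /2⌋) (m+[n∸m]≡n j≤n) ⟩
      k ^ suc ⌊ n /2⌋ ∎

  flip : Edge → Edge
  flip (a , d) = a , star d

  -- Comparing the maxima for d and `star d` leaves three cases: the edge lies in E, its `flip` lies
  -- in E, or d is achiral.
  allWords≤ : ∀ (E : List Edge) → (∀ {e} → Valid e → e ∈ E) →
              k * k ^ n ≤ length E + (length E + k * (suc n * k ^ suc ⌊ n /2⌋))
  allWords≤ E covers = begin
    k * k ^ n                                              ≡⟨ length-pairs (words n) (length-words n) ⟨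
    length (cartesianProduct (allFin k) (words n))
      ≤⟨ unique-⊆⇒length≤ (Unique.cartesianProduct⁺ (Unique.allFin⁺ k) (unique-words n)) inclusion ⟩
    length (E ++ map flip E ++ achirals)                   ≡⟨ length-++ E ⟩
    length E + length (map flip E ++ achirals)
      ≡⟨ cong (λ m → length E + m) (length-++ (map flip E)) ⟩
    length E + (length (map flip E) + length achirals)
      ≡⟨ cong₂ (λ a b → length E + (a + b)) (length-map flip E) (length-pairs achiral refl) ⟩
    length E + (length E + k * length achiral)
      ≤⟨ +-monoʳ-≤ (length E) (+-monoʳ-≤ (length E) (*-monoʳ-≤ k length-achiral≤)) ⟩
    length E + (length E + k * (suc n * k ^ suc ⌊ n /2⌋))  ∎
    where
    open ≤-Reasoning
    achirals : List Edge
    achirals = cartesianProduct (allFin k) achiral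
    length-pairs : ∀ (ds : List (List (Fin k))) {m} → length ds ≡ m →
                   length (cartesianProduct (allFin k) ds) ≡ k * m
    length-pairs ds l = trans (length-cartesianProductWith _,_ (allFin k) ds)
      (cong₂ _*_ length-letters l)
    classify : ∀ a d → length d ≡ n → (a , d) ∈ E ++ map flip E ++ achirals
    classify a d l with <-cmp (maxRot (star d)) (maxRot d)
    ... | tri< lt _ _ = ∈-++⁺ˡ (covers (isValid l lt))
    ... | tri≈ _ eq _ = ∈-++⁺ʳ E (∈-++⁺ʳ (map flip E)
                          (∈-cartesianProduct⁺ (∈-allFin a) (∈-achiral d l (sym eq))))
    ... | tri> _ _ gt = ∈-++⁺ʳ E (∈-++⁺ˡ (subst (_∈ map flip E) (cong (a ,_) (star-involutive d))
                          (∈-map⁺ flip (covers {a , star d} (isValid (trans (length-star d) l)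
                            (subst (_< maxRot (star d)) (cong maxRot (sym (star-involutive d))) gt))))))
    inclusion : ∀ {e} → e ∈ cartesianProduct (allFin k) (words n) → e ∈ E ++ map flip E ++ achirals
    inclusion {a , d} e∈ = classify a d (word-length n (proj₂ (∈-cartesianProduct⁻ (allFin k) (words n) e∈)))

-- Upper bound for periods, and both bounds for the maximal period

CongMod-bounded : ∀ {i j p} → i < p → j < p → CongMod i j p → i ≡ j
CongMod-bounded {i} i<p j<p (zero  , inj₁ eq) = trans (sym (+-identityʳ i)) eq
CongMod-bounded {j = j} i<p j<p (zero  , inj₂ eq) = sym (trans (sym (+-identityʳ j)) eq)
CongMod-bounded {i} {j} {p} i<p j<p (suc q , inj₁ eq) =
  contradiction (subst (p ≤_) eq (≤-trans (m≤m+n p (q * p)) (m≤n+m _ i))) (<⇒≱ j<p)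
CongMod-bounded {i} {j} {p} i<p j<p (suc q , inj₂ eq) =
  contradiction (subst (p ≤_) eq (≤-trans (m≤m+n p (q * p)) (m≤n+m _ j))) (<⇒≱ i<p)

funToFin-injective : ∀ {m k} (f g : Fin m → Fin k) → funToFin f ≡ funToFin g → ∀ i → f i ≡ g i
funToFin-injective f g eq i = trans (sym (finToFun-funToFin f i))
  (trans (cong (λ c → finToFun c i) eq) (finToFun-funToFin g i))

-- The p windows of one period and their p reversals are 2 p different words: windows differ by the
-- window property, reversals because reversal is injective, and orientability separates the two
-- kinds.
orientable⇒2p≤k^N : ∀ {k} (s : ℕ → Fin k) p N → IsOrientable s p N → p + p ≤ k ^ N
orientable⇒2p≤k^N {k} s p N ((_ , windows) , noReverse) =
  injective⇒≤ {f = code ∘ splitAt p} λ eq →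
    Injection.injective (↔⇒↣ (+↔⊎ {p} {p})) (code-injective _ _ eq)
  where
  forward backward : Fin p → Fin N → Fin k
  forward  i r = s (toℕ i + toℕ r)
  backward i r = s (toℕ i + (N ∸ 1 ∸ toℕ r))
  code : Fin p ⊎ Fin p → Fin (k ^ N)
  code (inj₁ i) = funToFin (forward i)
  code (inj₂ j) = funToFin (backward j)
  atℕ : ∀ {f g : ℕ → Fin k} → (∀ (r : Fin N) → f (toℕ r) ≡ g (toℕ r)) → ∀ r → r < N → f r ≡ g r
  atℕ {f} {g} h r r<N = subst (λ m → f m ≡ g m) (toℕ-fromℕ< r<N) (h (fromℕ< r<N))
  sameWindow⇒≡ : ∀ i j → SameWindow s N (toℕ i) (toℕ j) → i ≡ j
  sameWindow⇒≡ i j same = toℕ-injective (CongMod-bounded (toℕ<n i) (toℕ<n j) (windows (toℕ i) (toℕ j) same))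
  code-injective : ∀ x y → code x ≡ code y → x ≡ y
  code-injective (inj₁ i) (inj₁ j) eq = cong inj₁ (sameWindow⇒≡ i j
    (atℕ (funToFin-injective (forward i) (forward j) eq)))
  code-injective (inj₁ i) (inj₂ j) eq = contradiction
    (atℕ (funToFin-injective (forward i) (backward j) eq)) (noReverse (toℕ i) (toℕ j))
  code-injective (inj₂ i) (inj₁ j) eq = contradiction
    (atℕ (funToFin-injective (forward j) (backward i) (sym eq))) (noReverse (toℕ j) (toℕ i))
  -- Position r of a window is position N - 1 - r of its reversal, so equal reversals give equal
  -- windows.
  code-injective (inj₂ i) (inj₂ j) eq = cong inj₂ (sameWindow⇒≡ i j λ r r<N →
    subst (λ m → s (toℕ i + m) ≡ s (toℕ j + m)) (m∸[m∸n]≡n (∸-monoˡ-≤ 1 r<N))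
      (atℕ {λ r → s (toℕ i + (N ∸ 1 ∸ r))} {λ r → s (toℕ j + (N ∸ 1 ∸ r))}
        (funToFin-injective (backward i) (backward j) eq) (N ∸ 1 ∸ r)
        (≤-<-trans (m∸n≤m (N ∸ 1) r) (pred-< r<N))))
    where
    pred-< : ∀ {r} → r < N → N ∸ 1 < N
    pred-< r<N = ∸-monoʳ-< {o = 0} (s≤s z≤n) (≤-trans (s≤s z≤n) r<N)

-- The upper bound counts windows and reversals. The lower one compares L with the length p of the
-- Euler tour, since the tour, its image under `flip` and the achiral words account for all words of
-- length n + 1.
maxPeriod-bounds : ∀ k n L → 3 ≤ k → 3 ≤ n → IsMaxOrientablePeriod (n + 1) k L →
                   L + L ≤ k * k ^ n × k * k ^ n ≤ L + L + k * (suc n * k ^ suc ⌊ n /2⌋)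
maxPeriod-bounds (suc (suc (suc k″))) (suc n′) L (s≤s (s≤s (s≤s _))) _ ((s , orientable) , maximal) =
  subst (λ N → L + L ≤ k ^ N) (+-comm n 1) (orientable⇒2p≤k^N s L (n + 1) orientable) ,
  ≤-trans (allWords≤ (edges T) covers)
    (≤-trans (≤-reflexive (sym (+-assoc p p _))) (+-monoˡ-≤ _ (+-mono-≤ p≤L p≤L)))
  where
  open Tours k″ n′
  open Counting k″ n′
  open Tour
  T : Tour
  T = proj₁ eulerTour
  covers : ∀ {e} → Valid e → e ∈ edges T
  covers = proj₂ eulerTour
  open Sequence k″ n′ T using (p; seq; seq-orientable)
  p≤L : p ≤ L
  p≤L = maximal seq p (subst (IsOrientable seq p) (+-comm 1 n) seq-orientable)

-- Distance of the closed formula from k^n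

-- Strips one term b off a sum that is compared with c; used repeatedly until only the leading term
-- k^n is left.
∣a-b-c∣≤ : ∀ a b c → ℤ.∣ (a ℤ.- b) ℤ.- c ∣ ≤ ℤ.∣ a ℤ.- c ∣ + ℤ.∣ b ∣
∣a-b-c∣≤ a b c = subst (λ z → ℤ.∣ z ∣ ≤ ℤ.∣ a ℤ.- c ∣ + ℤ.∣ b ∣) (rearrange a b c)
  (ℤ.∣i-j∣≤∣i∣+∣j∣ (a ℤ.- c) b)
  where
  rearrange : ∀ a b c → (a ℤ.- c) ℤ.- b ≡ (a ℤ.- b) ℤ.- c
  rearrange = ℤ-RingSolver.solve-∀

∣a+b-c∣≤ : ∀ a b c → ℤ.∣ (a ℤ.+ b) ℤ.- c ∣ ≤ ℤ.∣ a ℤ.- c ∣ + ℤ.∣ b ∣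
∣a+b-c∣≤ a b c = subst (λ z → ℤ.∣ z ∣ ≤ ℤ.∣ a ℤ.- c ∣ + ℤ.∣ b ∣) (rearrange a b c)
  (ℤ.∣i+j∣≤∣i∣+∣j∣ (a ℤ.- c) b)
  where
  rearrange : ∀ a b c → (a ℤ.- c) ℤ.+ b ≡ (a ℤ.+ b) ℤ.- c
  rearrange = ℤ-RingSolver.solve-∀

∣i-i∣≡0 : ∀ i → ℤ.∣ i ℤ.- i ∣ ≡ 0
∣i-i∣≡0 i = cong ℤ.∣_∣ (ℤ.+-inverseʳ i)

δ≤2 : ∀ k → δ k ≤ 2
δ≤2 k with k % 2 ≟ 0
... | yes _ = ≤-refl
... | no _  = s≤s z≤n

oddPartAux≤ : ∀ f n → oddPartAux f n ≤ n
oddPartAux≤ zero    n       = ≤-refl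
oddPartAux≤ (suc f) zero    = z≤n
oddPartAux≤ (suc f) (suc n) with suc n % 2 ≟ 0
... | yes _ = ≤-trans (oddPartAux≤ f (suc n / 2)) (m/n≤m (suc n) 2)
... | no _  = ≤-refl

n/2≤⌊n/2⌋ : ∀ n → n / 2 ≤ ⌊ n /2⌋
n/2≤⌊n/2⌋ zero          = z≤n
n/2≤⌊n/2⌋ (suc zero)    = z≤n
n/2≤⌊n/2⌋ (suc (suc n)) = subst (_≤ suc ⌊ n /2⌋)
  (sym (m/n≡1+[m∸n]/n {suc (suc n)} {2} (s≤s (s≤s z≤n)))) (s≤s (n/2≤⌊n/2⌋ n))

-- Every correction term is at most a small multiple of N = n k^(⌊n/2⌋ + 1): the powers of k have
-- exponent at most ⌊n/2⌋, with one more factor k from δ² + k ≤ 3 k, and δ ≤ 2. For odd n the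
-- multiples give 6, for even n they give 3 + 2 + 4 + 2 = 11.
∣twiceSk-k^n∣≤ : ∀ k n → 3 ≤ k → 1 ≤ n →
                 ℤ.∣ twiceSk k n ℤ.- + (k ^ n) ∣ ≤ 11 * (n * k ^ suc ⌊ n /2⌋)
∣twiceSk-k^n∣≤ k n 3≤k 1≤n = bound
  where
  open ≤-Reasoning
  instance
    k-nonZero : NonZero k
    k-nonZero = ℕ.>-nonZero (≤-trans (s≤s z≤n) 3≤k)
    n-nonZero : NonZero n
    n-nonZero = ℕ.>-nonZero 1≤n
  K N d : ℕ
  K = k ^ suc ⌊ n /2⌋
  N = n * K
  d = δ k
  K≤N : K ≤ N
  K≤N = m≤n*m K n
  1≤N : 1 ≤ N
  1≤N = ≤-trans (m^n>0 k (suc ⌊ n /2⌋)) K≤N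
  pow≤K : ∀ m → m ≤ n → k ^ ((m ∸ 1) / 2) ≤ K
  pow≤K m m≤n = ^-monoʳ-≤ k (begin
    (m ∸ 1) / 2   ≤⟨ /-monoˡ-≤ 2 (≤-trans (m∸n≤m m 1) m≤n) ⟩
    n / 2         ≤⟨ n/2≤⌊n/2⌋ n ⟩
    ⌊ n /2⌋       ≤⟨ n≤1+n _ ⟩
    suc ⌊ n /2⌋   ∎)
  ∣x-1∣≤ : ∀ x → ℤ.∣ + x ℤ.- + 1 ∣ ≤ x + 1
  ∣x-1∣≤ x = ℤ.∣i-j∣≤∣i∣+∣j∣ (+ x) (+ 1)
  n*[x+1]≤ : ∀ {m x} → m ≤ n → x ≤ K → m * (x + 1) ≤ 2 * N
  n*[x+1]≤ {m} {x} m≤n x≤K = begin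
    m * (x + 1)    ≤⟨ *-mono-≤ m≤n (+-mono-≤ x≤K (m^n>0 k (suc ⌊ n /2⌋))) ⟩
    n * (K + K)    ≡⟨ double n K ⟩
    2 * N          ∎
    where
    double : ∀ n K → n * (K + K) ≡ 2 * (n * K)
    double = solve-∀
  4+k≤3k : d * d + k ≤ 3 * k
  4+k≤3k = begin
    d * d + k    ≤⟨ +-monoˡ-≤ k (*-mono-≤ (δ≤2 k) (δ≤2 k)) ⟩
    4 + k        ≤⟨ +-monoˡ-≤ k (≤-trans (n≤1+n 4) (≤-trans (n≤1+n 5) (*-monoʳ-≤ 2 3≤k))) ⟩
    2 * k + k    ≡⟨ triple k ⟩
    3 * k        ∎
    where
    triple : ∀ k → 2 * k + k ≡ 3 * k
    triple = solve-∀
  -- The three middle terms of the formula for even n, in its order; the remaining correction is δ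
  -- itself.
  B₁ B₂ B₃ : ℤ
  B₁ = + ((n / 2) * k ^ ((n ∸ 2) / 2)) ℤ.* + (d * d + k)
  B₂ = + (n * d * k ^ ((oddPart n ∸ 1) / 2))
  B₃ = + (oddPart n * d) ℤ.* (+ (k ^ ((oddPart n ∸ 1) / 2)) ℤ.- + 1)
  ∣B₁∣≤ : ℤ.∣ B₁ ∣ ≤ 3 * N
  ∣B₁∣≤ = begin
    ℤ.∣ B₁ ∣
      ≡⟨ ℤ.abs-* (+ ((n / 2) * k ^ ((n ∸ 2) / 2))) (+ (d * d + k)) ⟩
    (n / 2) * k ^ ((n ∸ 2) / 2) * (d * d + k)
      ≤⟨ *-mono-≤ (*-monoˡ-≤ (k ^ ((n ∸ 2) / 2)) (m/n≤m n 2)) 4+k≤3k ⟩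
    n * k ^ ((n ∸ 2) / 2) * (3 * k)                    ≡⟨ regroup n (k ^ ((n ∸ 2) / 2)) k ⟩
    3 * (n * k ^ suc ((n ∸ 2) / 2))
      ≤⟨ *-monoʳ-≤ 3 (*-monoʳ-≤ n (^-monoʳ-≤ k (s≤s (≤-trans (/-monoˡ-≤ 2 (m∸n≤m n 2)) (n/2≤⌊n/2⌋ n))))) ⟩
    3 * N                                              ∎
    where
    regroup : ∀ n x k → n * x * (3 * k) ≡ 3 * (n * (k * x))
    regroup = solve-∀
  ∣B₂∣≤ : ℤ.∣ B₂ ∣ ≤ 2 * N
  ∣B₂∣≤ = begin
    n * d * k ^ ((oddPart n ∸ 1) / 2)
      ≤⟨ *-mono-≤ (*-monoʳ-≤ n (δ≤2 k)) (pow≤K (oddPart n) (oddPartAux≤ n n)) ⟩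
    n * 2 * K                          ≡⟨ regroup n K ⟩
    2 * N                              ∎
    where
    regroup : ∀ n K → n * 2 * K ≡ 2 * (n * K)
    regroup = solve-∀
  ∣B₃∣≤ : ℤ.∣ B₃ ∣ ≤ 4 * N
  ∣B₃∣≤ = begin
    ℤ.∣ B₃ ∣                               ≡⟨ ℤ.abs-* (+ (oddPart n * d)) (+ km ℤ.- + 1) ⟩
    oddPart n * d * ℤ.∣ + km ℤ.- + 1 ∣     ≤⟨ *-mono-≤ (*-monoʳ-≤ (oddPart n) (δ≤2 k)) (∣x-1∣≤ km) ⟩
    oddPart n * 2 * (km + 1)               ≡⟨ regroup (oddPart n) (km + 1) ⟩
    2 * (oddPart n * (km + 1))
      ≤⟨ *-monoʳ-≤ 2 (n*[x+1]≤ (oddPartAux≤ n n) (pow≤K (oddPart n) (oddPartAux≤ n n))) ⟩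
    2 * (2 * N)                            ≡⟨ *-assoc 2 2 N ⟨
    4 * N                                  ∎
    where
    km : ℕ
    km = k ^ ((oddPart n ∸ 1) / 2)
    regroup : ∀ m x → m * 2 * x ≡ 2 * (m * x)
    regroup = solve-∀
  -- The bracket that is multiplied by δ in the formula for odd n.
  B : ℤ
  B = + n ℤ.* (+ (k ^ ((n ∸ 1) / 2)) ℤ.- + 1) ℤ.+ + 1
  ∣B∣≤ : ℤ.∣ B ∣ ≤ 3 * N
  ∣B∣≤ = begin
    ℤ.∣ B ∣
      ≤⟨ ℤ.∣i+j∣≤∣i∣+∣j∣ (+ n ℤ.* (+ X ℤ.- + 1)) (+ 1) ⟩
    ℤ.∣ + n ℤ.* (+ X ℤ.- + 1) ∣ + 1
      ≡⟨ cong (_+ 1) (ℤ.abs-* (+ n) (+ X ℤ.- + 1)) ⟩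
    n * ℤ.∣ + X ℤ.- + 1 ∣ + 1                                    ≤⟨ +-monoˡ-≤ 1 (*-monoʳ-≤ n (∣x-1∣≤ X)) ⟩
    n * (X + 1) + 1
      ≤⟨ +-mono-≤ (n*[x+1]≤ ≤-refl (pow≤K n ≤-refl)) 1≤N ⟩
    2 * N + N                                                    ≡⟨ +-comm (2 * N) N ⟩
    3 * N                                                        ∎
    where
    X : ℕ
    X = k ^ ((n ∸ 1) / 2)
  bound : ℤ.∣ twiceSk k n ℤ.- + (k ^ n) ∣ ≤ 11 * N
  bound with n % 2 ≟ 0
  ... | no _ = begin
    ℤ.∣ (+ (k ^ n) ℤ.- + d ℤ.* B) ℤ.- + (k ^ n) ∣        ≤⟨ ∣a-b-c∣≤ (+ (k ^ n)) (+ d ℤ.* B) (+ (k ^ n)) ⟩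
    ℤ.∣ + (k ^ n) ℤ.- + (k ^ n) ∣ + ℤ.∣ + d ℤ.* B ∣
      ≡⟨ cong₂ _+_ (∣i-i∣≡0 (+ (k ^ n))) (ℤ.abs-* (+ d) B) ⟩
    d * ℤ.∣ B ∣                                          ≤⟨ *-mono-≤ (δ≤2 k) ∣B∣≤ ⟩
    2 * (3 * N)                                          ≡⟨ *-assoc 2 3 N ⟨
    6 * N                                                ≤⟨ *-monoˡ-≤ N (m≤m+n 6 5) ⟩
    11 * N                                               ∎
  ... | yes _ = begin
    ℤ.∣ A ℤ.- B₁ ℤ.+ B₂ ℤ.- B₃ ℤ.- + d ℤ.- A ∣
      ≤⟨ ∣a-b-c∣≤ (A ℤ.- B₁ ℤ.+ B₂ ℤ.- B₃) (+ d) A ⟩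
    ℤ.∣ A ℤ.- B₁ ℤ.+ B₂ ℤ.- B₃ ℤ.- A ∣ + d
      ≤⟨ +-monoˡ-≤ d (∣a-b-c∣≤ (A ℤ.- B₁ ℤ.+ B₂) B₃ A) ⟩
    ℤ.∣ A ℤ.- B₁ ℤ.+ B₂ ℤ.- A ∣ + ℤ.∣ B₃ ∣ + d
      ≤⟨ +-monoˡ-≤ d (+-monoˡ-≤ ℤ.∣ B₃ ∣ (∣a+b-c∣≤ (A ℤ.- B₁) B₂ A)) ⟩
    ℤ.∣ A ℤ.- B₁ ℤ.- A ∣ + ℤ.∣ B₂ ∣ + ℤ.∣ B₃ ∣ + d
      ≤⟨ +-monoˡ-≤ d (+-monoˡ-≤ ℤ.∣ B₃ ∣ (+-monoˡ-≤ ℤ.∣ B₂ ∣ (∣a-b-c∣≤ A B₁ A))) ⟩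
    ℤ.∣ A ℤ.- A ∣ + ℤ.∣ B₁ ∣ + ℤ.∣ B₂ ∣ + ℤ.∣ B₃ ∣ + d
      ≡⟨ cong (λ z → z + ℤ.∣ B₁ ∣ + ℤ.∣ B₂ ∣ + ℤ.∣ B₃ ∣ + d) (∣i-i∣≡0 A) ⟩
    ℤ.∣ B₁ ∣ + ℤ.∣ B₂ ∣ + ℤ.∣ B₃ ∣ + d
      ≤⟨ +-mono-≤ (+-mono-≤ (+-mono-≤ ∣B₁∣≤ ∣B₂∣≤) ∣B₃∣≤) (≤-trans (δ≤2 k) (*-monoʳ-≤ 2 1≤N)) ⟩
    3 * N + 2 * N + 4 * N + 2 * N
      ≡⟨ collect N ⟩
    11 * N ∎
    where
    A : ℤ
    A = + (k ^ n)
    collect : ∀ N → 3 * N + 2 * N + 4 * N + 2 * N ≡ 11 * N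
    collect = solve-∀

-- Closeness of the ratio to 1

-- For ε = (m + 1)/q in lowest terms the hypothesis says that a/b differs from 1 by less than 1/q,
-- and 1/q ≤ ε. On unnormalised fractions the claim becomes a cross-multiplied inequality of
-- integers.
∣a/b-1∣<ε : ∀ a b .{{_ : NonZero b}} ε → 0ℚ ℚ.< ε → ℤ.∣ a ℤ.- + b ∣ * ℚ.denominatorℕ ε < b →
            ℚ.∣ a ℚ./ b ℚ.- 1ℚ ∣ ℚ.< ε
∣a/b-1∣<ε a (suc b) ε@(mkℚ (+ zero)  q-1 _) 0<ε _ with () ← ℚ.positive 0<ε
∣a/b-1∣<ε a (suc b) ε@(mkℚ -[1+ _ ]  q-1 _) 0<ε _ with () ← ℚ.positive 0<ε
∣a/b-1∣<ε a (suc b) ε@(mkℚ +[1+ m ] q-1 _) _ close =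
  ℚ.toℚᵘ-cancel-< (ℚᵘ.<-respˡ-≃ (ℚᵘ.≃-sym toℚᵘ-distance) (ℚᵘ.*<* (subst₂ ℤ._<_
    (ℤ.pos-* ℤ.∣ a ℤ.* + 1 ℤ.+ -[1+ 0 ] ℤ.* + suc b ∣ (suc q-1)) (ℤ.pos-* (suc m) (suc (b * 1))) (ℤ.+<+ (begin-strict
      ℤ.∣ a ℤ.* + 1 ℤ.+ -[1+ 0 ] ℤ.* + suc b ∣ * suc q-1
        ≡⟨ cong (λ z → ℤ.∣ z ∣ * suc q-1) (cong₂ ℤ._+_ (ℤ.*-identityʳ a) (ℤ.-1*i≡-i (+ suc b))) ⟩
      ℤ.∣ a ℤ.- + suc b ∣ * suc q-1
        <⟨ close ⟩
      suc b
        ≤⟨ m≤n*m (suc b) (suc m) ⟩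
      suc m * suc b
        ≡⟨ cong (λ z → suc m * suc z) (*-identityʳ b) ⟨
      suc m * suc (b * 1) ∎)))))
  where
  open ≤-Reasoning
  toℚᵘ-distance : ℚ.toℚᵘ ℚ.∣ a ℚ./ suc b ℚ.- 1ℚ ∣ ℚᵘ.≃ ℚᵘ.∣ mkℚᵘ a b ℚᵘ.- 1ℚᵘ ∣
  toℚᵘ-distance = ℚᵘ.≃-trans (ℚ.toℚᵘ-homo-∣-∣ (a ℚ./ suc b ℚ.- 1ℚ))
    (ℚᵘ.∣-∣-cong (ℚᵘ.≃-trans (ℚ.toℚᵘ-homo-+ (a ℚ./ suc b) (ℚ.- 1ℚ))
      (ℚᵘ.+-cong (ℚ.toℚᵘ-fromℚᵘ (mkℚᵘ a b)) ℚᵘ.≃-refl)))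


∣+m-+n∣≡m∸n : ∀ {m n} → n ≤ m → ℤ.∣ + m ℤ.- + n ∣ ≡ m ∸ n
∣+m-+n∣≡m∸n {m} {n} n≤m = cong ℤ.∣_∣ (trans (ℤ.m-n≡m⊖n m n) (ℤ.⊖-≥ n≤m))

∣i-k∣≤∣i-j∣+∣j-k∣ : ∀ i j k → ℤ.∣ i ℤ.- k ∣ ≤ ℤ.∣ i ℤ.- j ∣ + ℤ.∣ j ℤ.- k ∣
∣i-k∣≤∣i-j∣+∣j-k∣ i j k = subst (λ z → ℤ.∣ z ∣ ≤ ℤ.∣ i ℤ.- j ∣ + ℤ.∣ j ℤ.- k ∣) (telescope i j k)
  (ℤ.∣i+j∣≤∣i∣+∣j∣ (i ℤ.- j) (j ℤ.- k))
  where
  telescope : ∀ i j k → (i ℤ.- j) ℤ.+ (j ℤ.- k) ≡ i ℤ.- k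
  telescope = ℤ-RingSolver.solve-∀

-- Both quantities are compared with k k^n. The formula contributes 11, and the deficit of 2 L
-- contributes 2 because n + 1 ≤ 2 n.
∣k*twiceSk-2L∣≤ : ∀ k n L → 3 ≤ k → 3 ≤ n → IsMaxOrientablePeriod (n + 1) k L →
                  ℤ.∣ + k ℤ.* twiceSk k n ℤ.- + (2 * L) ∣ ≤ k * (13 * (n * k ^ suc ⌊ n /2⌋))
∣k*twiceSk-2L∣≤ k n L 3≤k 3≤n isMax = begin
  ℤ.∣ + k ℤ.* twiceSk k n ℤ.- + (2 * L) ∣
    ≤⟨ ∣i-k∣≤∣i-j∣+∣j-k∣ (+ k ℤ.* twiceSk k n) (+ (k * k ^ n)) (+ (2 * L)) ⟩
  ℤ.∣ + k ℤ.* twiceSk k n ℤ.- + (k * k ^ n) ∣ + ℤ.∣ + (k * k ^ n) ℤ.- + (2 * L) ∣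
    ≡⟨ cong₂ _+_ factor (∣+m-+n∣≡m∸n (subst (_≤ k * k ^ n) (sym 2L≡) (proj₁ bounds))) ⟩
  k * ℤ.∣ twiceSk k n ℤ.- + (k ^ n) ∣ + (k * k ^ n ∸ 2 * L)
    ≤⟨ +-mono-≤ (*-monoʳ-≤ k (∣twiceSk-k^n∣≤ k n 3≤k (≤-trans (s≤s z≤n) 3≤n))) deficit ⟩
  k * (11 * N) + k * (2 * N)
    ≡⟨ collect k N ⟩
  k * (13 * N) ∎
  where
  open ≤-Reasoning
  N : ℕ
  N = n * k ^ suc ⌊ n /2⌋
  bounds : L + L ≤ k * k ^ n × k * k ^ n ≤ L + L + k * (suc n * k ^ suc ⌊ n /2⌋)
  bounds = maxPeriod-bounds k n L 3≤k 3≤n isMax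
  2L≡ : 2 * L ≡ L + L
  2L≡ = cong (λ z → L + z) (+-identityʳ L)
  factor : ℤ.∣ + k ℤ.* twiceSk k n ℤ.- + (k * k ^ n) ∣ ≡ k * ℤ.∣ twiceSk k n ℤ.- + (k ^ n) ∣
  factor = trans (cong ℤ.∣_∣ (trans (cong (λ z → + k ℤ.* twiceSk k n ℤ.- z) (ℤ.pos-* k (k ^ n)))
      (distrib (+ k) (twiceSk k n) (+ (k ^ n)))))
    (ℤ.abs-* (+ k) (twiceSk k n ℤ.- + (k ^ n)))
    where
    distrib : ∀ a b c → a ℤ.* b ℤ.- a ℤ.* c ≡ a ℤ.* (b ℤ.- c)
    distrib = ℤ-RingSolver.solve-∀
  deficit : k * k ^ n ∸ 2 * L ≤ k * (2 * N)
  deficit = begin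
    k * k ^ n ∸ 2 * L                                          ≤⟨ ∸-monoˡ-≤ (2 * L) (proj₂ bounds) ⟩
    L + L + k * (suc n * k ^ suc ⌊ n /2⌋) ∸ 2 * L
      ≡⟨ cong (λ z → z + k * (suc n * k ^ suc ⌊ n /2⌋) ∸ 2 * L) 2L≡ ⟨
    2 * L + k * (suc n * k ^ suc ⌊ n /2⌋) ∸ 2 * L              ≡⟨ m+n∸m≡n (2 * L) _ ⟩
    k * (suc n * k ^ suc ⌊ n /2⌋)
      ≤⟨ *-monoʳ-≤ k (*-monoˡ-≤ (k ^ suc ⌊ n /2⌋) (+-monoˡ-≤ n (≤-trans (s≤s z≤n) 3≤n))) ⟩
    k * ((n + n) * k ^ suc ⌊ n /2⌋)                            ≡⟨ regroup k n (k ^ suc ⌊ n /2⌋) ⟩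
    k * (2 * N)                                                ∎
    where
    regroup : ∀ k n K → k * ((n + n) * K) ≡ k * (2 * (n * K))
    regroup = solve-∀
  collect : ∀ k N → k * (11 * N) + k * (2 * N) ≡ k * (13 * N)
  collect = solve-∀

-- With q the denominator of ε, closeness follows from 13 k N q < 2 L. Since k k^n ≤ 2 L + 2 k N, it
-- suffices that 13 k N q + 2 k N < k k^n, and as q ≥ 1 this follows from 15 q N < k^n. Dividing by
-- K = k^(⌊n/2⌋ + 1) gives the last hypothesis.
ratio-close : ∀ k n L .{{_ : NonZero L}} ε → 3 ≤ k → 3 ≤ n → 0ℚ ℚ.< ε → IsMaxOrientablePeriod (n + 1) k L →
              15 * ℚ.denominatorℕ ε * n < k ^ (n ∸ suc ⌊ n /2⌋) → ℚ.∣ ratio k n L ℚ.- 1ℚ ∣ ℚ.< ε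
ratio-close k n L ε 3≤k 3≤n 0<ε isMax large =
  ∣a/b-1∣<ε (+ k ℤ.* twiceSk k n) (2 * L) {{m*n≢0 2 L}} ε 0<ε
    (≤-<-trans (*-monoˡ-≤ q (∣k*twiceSk-2L∣≤ k n L 3≤k 3≤n isMax))
      (+-cancelʳ-< (k * (2 * N)) (k * (13 * N) * q) (2 * L) (begin-strict
        k * (13 * N) * q + k * (2 * N)
          ≤⟨ +-monoʳ-≤ (k * (13 * N) * q) (m≤m*n (k * (2 * N)) q) ⟩
        k * (13 * N) * q + k * (2 * N) * q
          ≡⟨ collect k n K q ⟩
        k * (15 * q * n * K)
          <⟨ *-monoʳ-< k (*-monoˡ-< K large) ⟩
        k * (k ^ (n ∸ suc ⌊ n /2⌋) * K)
          ≡⟨ cong (k *_) (^-distribˡ-+-* k (n ∸ suc ⌊ n /2⌋) (suc ⌊ n /2⌋)) ⟨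
        k * k ^ (n ∸ suc ⌊ n /2⌋ + suc ⌊ n /2⌋)
          ≡⟨ cong (λ m → k * k ^ m) (m∸n+n≡m (1+⌊n/2⌋≤n 3≤n)) ⟩
        k * k ^ n
          ≤⟨ proj₂ (maxPeriod-bounds k n L 3≤k 3≤n isMax) ⟩
        L + L + k * (suc n * K)
          ≤⟨ +-mono-≤ (≤-reflexive (cong (λ z → L + z) (sym (+-identityʳ L))))
               (*-monoʳ-≤ k (*-monoˡ-≤ K (+-monoˡ-≤ n (≤-trans (s≤s z≤n) 3≤n)))) ⟩
        2 * L + k * ((n + n) * K)
          ≡⟨ regroup (2 * L) k n K ⟩
        2 * L + k * (2 * N) ∎)))
  where
  open ≤-Reasoning
  q K N : ℕ
  q = ℚ.denominatorℕ ε
  K = k ^ suc ⌊ n /2⌋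
  N = n * K
  instance
    k-nonZero : NonZero k
    k-nonZero = ℕ.>-nonZero (≤-trans (s≤s z≤n) 3≤k)
    K-nonZero : NonZero K
    K-nonZero = m^n≢0 k (suc ⌊ n /2⌋)
  1+⌊n/2⌋≤n : ∀ {n} → 3 ≤ n → suc ⌊ n /2⌋ ≤ n
  1+⌊n/2⌋≤n {suc n} _ = ⌊n/2⌋<n n
  collect : ∀ k n K q → k * (13 * (n * K)) * q + k * (2 * (n * K)) * q ≡ k * (15 * q * n * K)
  collect = solve-∀
  regroup : ∀ l k n K → l + k * ((n + n) * K) ≡ l + k * (2 * (n * K))
  regroup = solve-∀

-- Thresholds for the two limits

n∸1+⌊n/2⌋ : ∀ n → suc n ∸ suc ⌊ suc n /2⌋ ≡ ⌊ n /2⌋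
n∸1+⌊n/2⌋ n = trans (cong (_∸ ⌈ n /2⌉) (sym (⌊n/2⌋+⌈n/2⌉≡n n))) (m+n∸n≡m ⌊ n /2⌋ ⌈ n /2⌉)

1+n≤2*[1+⌊n/2⌋] : ∀ n → suc n ≤ 2 * suc ⌊ n /2⌋
1+n≤2*[1+⌊n/2⌋] zero          = s≤s z≤n
1+n≤2*[1+⌊n/2⌋] (suc zero)    = ≤-refl
1+n≤2*[1+⌊n/2⌋] (suc (suc n)) = ≤-trans (s≤s (s≤s (1+n≤2*[1+⌊n/2⌋] n)))
  (≤-reflexive (sym (*-suc 2 (suc ⌊ n /2⌋))))

1+n≤2^n : ∀ n → suc n ≤ 2 ^ n
1+n≤2^n zero    = ≤-refl
1+n≤2^n (suc n) = begin
  suc (suc n)      ≤⟨ +-mono-≤ (m^n>0 2 n) (1+n≤2^n n) ⟩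
  2 ^ n + 2 ^ n    ≡⟨ cong (λ z → 2 ^ n + z) (+-identityʳ (2 ^ n)) ⟨
  2 ^ suc n        ∎
  where open ≤-Reasoning

-- The exponent is e = ⌊(n - 1)/2⌋; put f = ⌊e/2⌋. Then k^e ≥ (k^f)^2 ≥ (f + 1)^2 is quadratic in f,
-- whereas n ≤ 4 (f + 1) is linear. The threshold on n forces f + 1 > 60 q = 4 · 15 q, which decides
-- the comparison.
large-n : ∀ q k n → 3 ≤ k → 4 * suc (60 * q) ≤ n → 15 * q * n < k ^ (n ∸ suc ⌊ n /2⌋)
large-n q k (suc n) 3≤k n₀≤n = subst (λ e → 15 * q * suc n < k ^ e) (sym (n∸1+⌊n/2⌋ n)) (begin-strict
  15 * q * suc n         ≤⟨ *-monoʳ-≤ (15 * q) n≤ ⟩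
  15 * q * (4 * suc f)   ≡⟨ regroup q (suc f) ⟩
  60 * q * suc f         <⟨ *-monoˡ-< (suc f) (*-cancelˡ-≤ 4 (≤-trans n₀≤n n≤)) ⟩
  suc f * suc f          ≤⟨ *-mono-≤ 1+f≤ 1+f≤ ⟩
  k ^ f * k ^ f          ≡⟨ ^-distribˡ-+-* k f f ⟨
  k ^ (f + f)
    ≤⟨ ^-monoʳ-≤ k (≤-trans (+-monoʳ-≤ f (⌊n/2⌋≤⌈n/2⌉ e)) (≤-reflexive (⌊n/2⌋+⌈n/2⌉≡n e))) ⟩
  k ^ e                  ∎)
  where
  open ≤-Reasoning
  instance
    k-nonZero : NonZero k
    k-nonZero = ℕ.>-nonZero (≤-trans (s≤s z≤n) 3≤k)
  e f : ℕ
  e = ⌊ n /2⌋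
  f = ⌊ e /2⌋
  n≤ : suc n ≤ 4 * suc f
  n≤ = begin
    suc n              ≤⟨ 1+n≤2*[1+⌊n/2⌋] n ⟩
    2 * suc e          ≤⟨ *-monoʳ-≤ 2 (1+n≤2*[1+⌊n/2⌋] e) ⟩
    2 * (2 * suc f)    ≡⟨ *-assoc 2 2 (suc f) ⟨
    4 * suc f          ∎
  1+f≤ : suc f ≤ k ^ f
  1+f≤ = ≤-trans (1+n≤2^n f) (^-monoˡ-≤ f (≤-trans (n≤1+n 2) 3≤k))
  regroup : ∀ q g → 15 * q * (4 * g) ≡ 60 * q * g
  regroup = solve-∀

-- From n ≥ 3 the exponent is at least 1, so the power is at least k.
large-k : ∀ q k n → 3 ≤ n → suc (15 * q * n) ≤ k → 15 * q * n < k ^ (n ∸ suc ⌊ n /2⌋)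
large-k q k (suc (suc (suc n))) (s≤s (s≤s (s≤s _))) k₀≤k = ≤-trans k₀≤k
  (subst (λ e → k ≤ k ^ e) (sym (n∸1+⌊n/2⌋ (suc (suc n)))) (m≤m*n k (k ^ ⌊ n /2⌋) {{m^n≢0 k ⌊ n /2⌋}}))
  where
  instance
    k-nonZero : NonZero k
    k-nonZero = ℕ.>-nonZero (≤-trans (s≤s z≤n) k₀≤k)

theorem5p11 : (∀ (k : ℕ) → 3 ≤ k → ∀ (ε : ℚ) → 0ℚ ℚ.< ε →
    ∃ λ (n₀ : ℕ) → ∀ (n : ℕ) → 3 ≤ n → n₀ ≤ n →
    ∀ (L : ℕ) .{{_ : NonZero L}} → IsMaxOrientablePeriod (n + 1) k L →
    ℚ.∣ ratio k n L ℚ.- 1ℚ ∣ ℚ.< ε)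
    ×
    (∀ (n : ℕ) → 3 ≤ n → ∀ (ε : ℚ) → 0ℚ ℚ.< ε →
    ∃ λ (k₀ : ℕ) → ∀ (k : ℕ) → 3 ≤ k → k₀ ≤ k →
    ∀ (L : ℕ) .{{_ : NonZero L}} → IsMaxOrientablePeriod (n + 1) k L →
    ℚ.∣ ratio k n L ℚ.- 1ℚ ∣ ℚ.< ε)
theorem5p11 =
  (λ k 3≤k ε 0<ε → 4 * suc (60 * ℚ.denominatorℕ ε) , λ n 3≤n n₀≤n L isMax →
    ratio-close k n L ε 3≤k 3≤n 0<ε isMax (large-n (ℚ.denominatorℕ ε) k n 3≤k n₀≤n)) ,
  (λ n 3≤n ε 0<ε → suc (15 * ℚ.denominatorℕ ε * n) , λ k 3≤k k₀≤k L isMax →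
    ratio-close k n L ε 3≤k 3≤n 0<ε isMax (large-k (ℚ.denominatorℕ ε) k n 3≤n k₀≤k))
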